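{- Let $k>2$ be an integer. There exist infinitely many irreducible polynomials $f$ over $\mathbb{Q}$ such that the splitting field $\mathbb{Q}_f$ of $f$ over $\mathbb{Q}$ has two minimal generating sets of different cardinalities: one of cardinality $2$ and another of cardinality $k$. In fact, one can obtain infinitely many such polynomials of the same degree as well.
   Context: For an irreducible polynomial $f$ over $\mathbb{Q}$ with set of roots $R\subset\bar{\mathbb{Q}}$ and splitting field $\mathbb{Q}_f$, a set $B\subset R$ is a minimal generating set of the splitting field of $f$ over $\mathbb{Q}$ if $\mathbb{Q}(B)=\mathbb{Q}_f$ and $\mathbb{Q}(A)\neq\mathbb{Q}_f$ for every $A\subsetneq B$. -}

module Defs where

open import Algebra.Apartness.Bundles using (HeytingField; HeytingCommutativeRing)
open import Algebra.Bundles using (CommutativeRing; RawSemiring)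
import Algebra.Definitions.RawSemiring as RawSemiringDefinitions
import Algebra.Definitions.RawMagma as RawMagmaDefinitions
open import Algebra.Morphism.Structures using (module RingMorphisms)
open import Data.Fin.Base using (Fin)
open import Data.List.Base using (List; []; _∷_; map)
open import Data.Nat.Base using (ℕ; zero; suc; _<_)
open import Data.Product.Base using (Σ; ∃; _×_; _,_; proj₁)
open import Data.Rational.Base using (ℚ)
open import Data.Rational.Base using () renaming (+-*-rawRing to ℚ-rawRing)
open import Data.Rational.Properties using () renaming (+-*-commutativeRing to ℚ-commutativeRing)
open import Function.Bundles using (Bijection)
open import Level using (Level; _⊔_) renaming (suc to lsuc)
open import Relation.Binary.Bundles using (Setoid)
import Relation.Binary.Construct.On as On
open import Relation.Binary.Definitions using (_Respects_)
open import Relation.Binary.PropositionalEquality using (_≡_)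
import Relation.Binary.PropositionalEquality.Properties as ≡
open import Relation.Nullary.Negation.Core using (¬_)
open import Relation.Unary using (Pred; _∈_; _⊆_; _⊂_; _≐_)

-- Univariate polynomials over R as lists of coefficients, constant term
-- first. Trailing zeros are allowed, so equality is _≈ₚ_ and not _≡_.
module Polynomials {c ℓ : Level} (R : CommutativeRing c ℓ) where
  open CommutativeRing R

  Poly : Set c
  Poly = List Carrier

  coeff : Poly → ℕ → Carrier
  coeff []       _       = 0#
  coeff (a ∷ _)  zero    = a
  coeff (_ ∷ as) (suc i) = coeff as i

  infix 4 _≈ₚ_
  _≈ₚ_ : Poly → Poly → Set ℓ
  p ≈ₚ q = ∀ i → coeff p i ≈ coeff q i

  infixl 6 _+ₚ_
  _+ₚ_ : Poly → Poly → Poly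
  []       +ₚ q        = q
  (a ∷ as) +ₚ []       = a ∷ as
  (a ∷ as) +ₚ (b ∷ bs) = (a + b) ∷ (as +ₚ bs)

  infixl 7 _*ₚ_
  _*ₚ_ : Poly → Poly → Poly
  []       *ₚ q = []
  (a ∷ as) *ₚ q = map (a *_) q +ₚ (0# ∷ (as *ₚ q))

  eval : Poly → Carrier → Carrier
  eval []       x = 0#
  eval (a ∷ as) x = a + x * eval as x

  HasDegree : Poly → ℕ → Set ℓ
  HasDegree p d = ¬ (coeff p d ≈ 0#) × (∀ i → d < i → coeff p i ≈ 0#)

  rawSemiring : RawSemiring c ℓ
  rawSemiring = record
    { Carrier = Poly
    ; _≈_     = _≈ₚ_
    ; _+_     = _+ₚ_
    ; _*_     = _*ₚ_
    ; 0#      = []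
    ; 1#      = 1# ∷ []
    }

open Polynomials ℚ-commutativeRing public
  using () renaming (Poly to ℚ[X]; HasDegree to HasDegreeℚ; rawSemiring to ℚ[X]-rawSemiring)

open RawSemiringDefinitions ℚ[X]-rawSemiring public using (Irreducible)
open RawMagmaDefinitions (RawSemiring.*-rawMagma ℚ[X]-rawSemiring) public
  using () renaming (_∥_ to Associated)

-- Counted up to associates, since f and c·f (c ≠ 0) have the same roots:
-- counting polynomials literally would make any single example infinite
-- by scaling.
InfinitelyMany : {p : Level} → Pred ℚ[X] p → Set p
InfinitelyMany P =
  Σ (ℕ → ℚ[X]) λ f → (∀ n → P (f n)) × (∀ m n → Associated (f m) (f n) → m ≡ n)

record AlgebraicClosure (c ℓ₁ ℓ₂ : Level) : Set (lsuc (c ⊔ ℓ₁ ⊔ ℓ₂)) where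
  field
    heytingField : HeytingField c ℓ₁ ℓ₂

  open HeytingField heytingField public

  commutativeRing : CommutativeRing c ℓ₁
  commutativeRing = HeytingCommutativeRing.commutativeRing heytingCommutativeRing

  open Polynomials commutativeRing public using (Poly; eval; HasDegree)
  open RingMorphisms ℚ-rawRing (CommutativeRing.rawRing commutativeRing)
    using (IsRingHomomorphism)

  field
    ι                  : ℚ → Carrier
    ι-isHomomorphism   : IsRingHomomorphism ι
    algebraic          : ∀ x → Σ ℚ[X] λ f →
                           ∃ (HasDegreeℚ f) × eval (map ι f) x ≈ 0#
    algebraicallyClosed : ∀ (p : Poly) d → HasDegree p (suc d) →
                           Σ Carrier λ x → eval p x ≈ 0#

module _ {c ℓ₁ ℓ₂ : Level} (ℚ̄ : AlgebraicClosure c ℓ₁ ℓ₂) where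
  open AlgebraicClosure ℚ̄

  Roots : ℚ[X] → Pred Carrier ℓ₁
  Roots f x = eval (map ι f) x ≈ 0#

  -- The subfield ℚ(S) of ℚ̄.
  data Adjoin {s : Level} (S : Pred Carrier s) : Pred Carrier (c ⊔ ℓ₁ ⊔ s) where
    gen  : ∀ {x}   → x ∈ S → Adjoin S x
    rat  : ∀ q     → Adjoin S (ι q)
    add  : ∀ {x y} → Adjoin S x → Adjoin S y → Adjoin S (x + y)
    neg  : ∀ {x}   → Adjoin S x → Adjoin S (- x)
    mul  : ∀ {x y} → Adjoin S x → Adjoin S y → Adjoin S (x * y)
    inv  : ∀ {x y} → Adjoin S x → x * y ≈ 1# → Adjoin S y
    resp : ∀ {x y} → x ≈ y → Adjoin S x → Adjoin S y

  SplittingField : ℚ[X] → Pred Carrier (c ⊔ ℓ₁)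
  SplittingField f = Adjoin (Roots f)

  -- A subset of ℚ̄ is a predicate invariant under _≈_. Without invariance,
  -- A could be a proper sub-predicate of B that misses only other
  -- representatives of elements it already contains.
  record IsMinimalGeneratingSet (f : ℚ[X]) (B : Pred Carrier (c ⊔ ℓ₁)) :
         Set (lsuc (c ⊔ ℓ₁)) where
    field
      respects  : B Respects _≈_
      roots     : B ⊆ Roots f
      generates : Adjoin B ≐ SplittingField f
      minimal   : ∀ (A : Pred Carrier (c ⊔ ℓ₁)) → A Respects _≈_ →
                  A ⊂ B → ¬ (Adjoin A ≐ SplittingField f)

  HasCardinality : Pred Carrier (c ⊔ ℓ₁) → ℕ → Set (c ⊔ ℓ₁)
  HasCardinality B m = Bijection (≡.setoid (Fin m)) (On.setoid setoid (proj₁ {B = B}))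

  HasMinimalGeneratingSetOfSize : ℚ[X] → ℕ → Set (lsuc (c ⊔ ℓ₁))
  HasMinimalGeneratingSetOfSize f m =
    Σ (Pred Carrier (c ⊔ ℓ₁)) λ B → IsMinimalGeneratingSet f B × HasCardinality B m

{-# OPTIONS --safe #-}

-- Choose quartics (X² − u)² − w, one for each j < k, with u² − w = d, such
-- that all the d and w are independent modulo squares.  The splitting fields
-- then have group D₄ and are linearly disjoint, so the minimal polynomial f of
-- a sum of one root of each quartic has group D₄^k acting on 4^k points, and
-- ℚ(Σ tⱼ) = ℚ(t₀, …, tₖ₋₁).  The roots of the j-th quartic are ± θ and
-- ± θ̄ with θ θ̄ = √d, and ℚ(θ) ≠ ℚ(θ̄).  Hence {Σ θⱼ, Σ θ̄ⱼ} is a minimal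
-- generating set.  So are, for k ≥ 2, the k sums bᵢ obtained from Σ θⱼ by
-- replacing θᵢ with θ̄ᵢ: bᵢ is the only one whose i-th summand is θ̄ᵢ.
-- The dilations f(2ⁿ X) have the same splitting field and the same degree.
--
-- Being outside a subfield is always reduced to a square root not lying in a
-- field F, by descent along F(r) ⊇ F: if t² ∈ F and t ∈ F(r), then t ∈ F or
-- t r ∈ F.  Irreducibility needs no degree count: rational polynomials
-- vanishing at one root of f vanish at all of them, and the roots are simple.
module Submission where

open import Defs
open import Data.Nat.Base using (ℕ; _<_)
open import Data.Product.Base using (Σ; _×_)
open import Level using (Level)

open import Level using (_⊔_; Lift; lift)
open import Algebra.Bundles using (CommutativeRing)
open import Algebra.Definitions.RawMagma using () renaming (_,_ to _∣,_)
open import Algebra.Morphism.Structures using (module RingMorphisms)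
import Algebra.Properties.Ring as RingProperties
import Algebra.Solver.Ring as RingSolver
open import Algebra.Solver.Ring.AlmostCommutativeRing using (fromCommutativeRing; _-Raw-AlmostCommutative⟶_)
open import Data.Fin.Base using (Fin; zero; suc; toℕ; fromℕ<)
import Data.Fin.Properties as Fin
open import Data.Integer.Base as ℤ using (ℤ; +_; ∣_∣)
import Data.Integer.Properties as ℤ
open import Data.Integer.Solver using () renaming (module +-*-Solver to ℤ-Solver)
open import Data.List.Base using (List; []; _∷_; map; length; downFrom; filter)
open import Data.List.Membership.Propositional using () renaming (_∈_ to _∈ₗ_)
open import Data.List.Membership.Propositional.Properties using (∈-downFrom⁺; ∈-downFrom⁻; ∈-filter⁺)
open import Data.List.Relation.Unary.All as All using (All; []; _∷_)
open import Data.List.Relation.Unary.All.Properties using (all-filter)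
open import Data.List.Relation.Unary.AllPairs using ([]; _∷_)
open import Data.List.Relation.Unary.Any using (here; there)
open import Data.List.Relation.Unary.Unique.Propositional using (Unique)
open import Data.List.Relation.Unary.Unique.Propositional.Properties using (downFrom⁺; filter⁺)
import Data.Maybe.Base as Maybe
open import Data.Nat.Base as ℕ using (zero; suc)
open import Data.Nat.Coprimality as Coprimality using (Coprime; coprime-divisor; 1-coprimeTo)
open import Data.Nat.Divisibility
  using (_∣_; divides; ∣-refl; ∣-trans; ∣-antisym; *-pres-∣; m∣m*n; n∣m*n; 1∣_; ∣1⇒≡1; ∣m+n∣m⇒∣n; ∣m⇒∣m*n)
open import Data.Nat.GCD using (gcd; gcd[m,n]∣m; gcd[m,n]∣n; c*gcd[m,n]≡gcd[cm,cn]; gcd-greatest)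
import Data.Nat.Properties as ℕ
open import Data.Nat.Solver using () renaming (module +-*-Solver to ℕ-Solver)
open import Data.Product.Base using (∃; _,_; proj₁; proj₂)
open import Data.Rational.Base as ℚ using (ℚ; mkℚ; 0ℚ; 1ℚ; toℚᵘ)
import Data.Rational.Properties as ℚ
open import Data.Rational.Unnormalised.Base as ℚᵘ using (mkℚᵘ; *≡*)
import Data.Rational.Unnormalised.Properties as ℚᵘ
open import Data.Sum.Base as Sum using (_⊎_; inj₁; inj₂)
open import Function.Base using (_∘_)
open import Relation.Binary.Definitions using (tri<; tri≈; tri>)
open import Relation.Binary.PropositionalEquality as ≡ using (_≡_; _≢_)
import Relation.Binary.Reasoning.Setoid as SetoidReasoning
open import Relation.Nullary.Decidable.Core using (yes; no; Dec; dec⇒maybe; ¬?)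
open import Relation.Nullary.Negation.Core using (¬_; contradiction)
open import Relation.Unary using (Pred; _⊆_)

open import Algebra.Properties.Group ℚ.+-0-group using () renaming (x∙y⁻¹≈ε⇒x≈y to p-q≡0⇒p≡q)
open Polynomials ℚ.+-*-commutativeRing using (_+ₚ_; _*ₚ_; _≈ₚ_) renaming (coeff to coeffℚ)


-- No Galois theory is used. That the roots of one quartic are interchangeable over a field F is
-- expressed by the linear independence of 1, r, t, r t over F, where t² = u + r: a relation g(x -
-- t) = 0 with x in F then holds for every root t. Accordingly `f` is an iterated norm, and
-- statements about its roots go by induction on the number of summands, the earlier ones lying in a
-- tower `L` over which the next quartic keeps its full group. Membership in a subfield is never
-- decided, only equality is, so quadratic extensions are given by explicit coordinates, and their
-- field structure does not depend on the adjoined root being new. Constants: with P twice the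
-- product of the earlier w, both d = P² + 1 and e = P² d - 1 lie strictly between consecutive
-- squares. Taking u = P d gives w = u² - d = d e, so modulo squares d, w and w d are d, d e and e.
-- If an integer n has a square root in the tower, n m is a square for some divisor m of the product
-- of the w in use; coprimality then excludes the next d, w and w d.

-- Pairwise coprime integer parameters

module Parameters where
  open import Data.Nat.Base using (_+_; _*_; _∸_; _≤_; z≤n; s≤s; >-nonZero; >-nonZero⁻¹)
  open import Data.Nat.Properties
  open ≡ using (refl; sym; trans; cong; subst; module ≡-Reasoning)
  open ℕ-Solver

  IsSquare : ℕ → Set
  IsSquare n = ∃ λ s → s * s ≡ n

  -- The slack `c` encodes n < (m + 1)² as an equation, which the ring solver can check.
  nonsquare-between : ∀ m {n} c → m * m < n → suc n + c ≡ suc m * suc m → ¬ IsSquare n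
  nonsquare-between m {n} c lo hi (s , s²≡n) with s ℕ.≤? m
  ... | yes s≤m = <⇒≱ lo (subst (_≤ m * m) s²≡n (*-mono-≤ s≤m s≤m))
  ... | no  s≰m = <⇒≱ (m+n≤o⇒m≤o (suc n) (≤-reflexive hi))
                      (subst (suc m * suc m ≤_) s²≡n (*-mono-≤ (≰⇒> s≰m) (≰⇒> s≰m)))

  -- The root is g = gcd(a, s). Its square divides a b and is coprime to b, hence divides a.
  -- Conversely a divides s a and s² = a b, hence g s; dividing also g a, it divides g².
  coprime-factor-square : ∀ {a b} → Coprime a b → IsSquare (a * b) → IsSquare a
  coprime-factor-square {a} {b} a⊥b (s , s²≡ab) = g , ∣-antisym g²∣a a∣g²
    where
    g = gcd a s

    g²∣a : g * g ∣ a
    g²∣a = coprime-divisor g²⊥b (subst (g * g ∣_) (trans s²≡ab (*-comm a b))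
                                       (*-pres-∣ (gcd[m,n]∣n a s) (gcd[m,n]∣n a s)))
      where
      g⊥b : Coprime g b
      g⊥b (i∣g , i∣b) = a⊥b (∣-trans i∣g (gcd[m,n]∣m a s) , i∣b)

      g²⊥b : Coprime (g * g) b
      g²⊥b (i∣g² , i∣b) = g⊥b (coprime-divisor (λ (j∣i , j∣g) → g⊥b (j∣g , ∣-trans j∣i i∣b)) i∣g² , i∣b)

    a∣gs : a ∣ g * s
    a∣gs = subst (a ∣_) (trans (sym (c*gcd[m,n]≡gcd[cm,cn] s a s)) (*-comm s g))
             (gcd-greatest (n∣m*n s) (subst (a ∣_) (sym s²≡ab) (m∣m*n b)))

    a∣g² : a ∣ g * g
    a∣g² = subst (a ∣_) (sym (c*gcd[m,n]≡gcd[cm,cn] g a s)) (gcd-greatest (n∣m*n g) a∣gs)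

  coprime-* : ∀ {a b c} → Coprime a b → Coprime a c → Coprime a (b * c)
  coprime-* a⊥b a⊥c (i∣a , i∣bc) =
    a⊥c (i∣a , coprime-divisor (λ (j∣i , j∣b) → a⊥b (∣-trans j∣i i∣a , j∣b)) i∣bc)

  coprime-∣ : ∀ {a b c} → c ∣ b → Coprime a b → Coprime a c
  coprime-∣ c∣b a⊥b (i∣a , i∣c) = a⊥b (i∣a , ∣-trans i∣c c∣b)

  suc≡multiple⇒coprime : ∀ {a b c} → suc a ≡ b * c → Coprime a b
  suc≡multiple⇒coprime {a} {b} {c} eq {i} (i∣a , i∣b) =
    ∣1⇒≡1 (∣m+n∣m⇒∣n {m = a} (subst (i ∣_) (trans (sym eq) (+-comm 1 a)) (∣m⇒∣m*n c i∣b)) i∣a)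

  -- As u² − w = d, the quartic (X² − u)² − w has group D₄ as soon as d, w and
  -- d w are not squares.  Since d and e = (d − 1) d − 1 are coprime to P and to
  -- each other, replacing P by P d e makes the parameters pairwise coprime.
  -- (The truncated subtraction in e is harmless because P ≥ 2.)
  abstract
    Pn : ℕ → ℕ
    dn en wn un : ℕ → ℕ

    Pn zero    = 2
    Pn (suc j) = Pn j * wn j
    dn j = suc (Pn j * Pn j)
    en j = (Pn j * Pn j) * (Pn j * Pn j) + (Pn j * Pn j ∸ 1)
    wn j = dn j * en j
    un j = Pn j * dn j

    Pn≥2 : ∀ j → 2 ≤ Pn j
    Pn≥2 zero    = ≤-refl
    Pn≥2 (suc j) = ≤-trans (Pn≥2 j) (m≤m*n (Pn j) (wn j) {{m*n≢0 (dn j) (en j) {{_}} {{en≢0}}}})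
      where
      instance
        P≢0 : ℕ.NonZero (Pn j)
        P≢0 = >-nonZero (≤-trans (s≤s z≤n) (Pn≥2 j))
        P²≢0 : ℕ.NonZero (Pn j * Pn j)
        P²≢0 = m*n≢0 (Pn j) (Pn j)
        P⁴≢0 : ℕ.NonZero ((Pn j * Pn j) * (Pn j * Pn j))
        P⁴≢0 = m*n≢0 (Pn j * Pn j) (Pn j * Pn j)
      en≢0 : ℕ.NonZero (en j)
      en≢0 = >-nonZero (≤-trans (>-nonZero⁻¹ _ {{P⁴≢0}}) (m≤m+n _ _))

    P²≡suc : ∀ j → ∃ λ Q → Pn j * Pn j ≡ suc (suc Q)
    P²≡suc j with Pn j | Pn≥2 j
    ... | suc (suc p) | _ = _ , refl
    ... | suc zero    | s≤s ()

    suc-e : ∀ j → suc (en j) ≡ (Pn j * Pn j) * dn j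
    suc-e j with Pn j * Pn j | P²≡suc j
    ... | _ | Q , refl = solve 1 (λ q → con 1 :+ ((con 2 :+ q) :* (con 2 :+ q) :+ (con 1 :+ q))
                                          := (con 2 :+ q) :* (con 3 :+ q)) refl Q

    u²≡w+d : ∀ j → un j * un j ≡ wn j + dn j
    u²≡w+d j = begin
      un j * un j                        ≡⟨ solve 2 (λ p d → (p :* d) :* (p :* d) := d :* ((p :* p) :* d)) refl (Pn j) (dn j) ⟩
      dn j * ((Pn j * Pn j) * dn j)      ≡⟨ cong (dn j *_) (suc-e j) ⟨
      dn j * suc (en j)                  ≡⟨ *-suc (dn j) (en j) ⟩
      dn j + wn j                        ≡⟨ +-comm (dn j) (wn j) ⟩
      wn j + dn j                        ∎
      where
      open ≡-Reasoning

    d-nonsquare : ∀ j → ¬ IsSquare (dn j)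
    d-nonsquare j with Pn j | Pn≥2 j
    ... | suc p | _ = nonsquare-between (suc p) (1 + 2 * p) ≤-refl
      (solve 1 (λ p → (con 2 :+ (con 1 :+ p) :* (con 1 :+ p)) :+ (con 1 :+ con 2 :* p)
                        := (con 2 :+ p) :* (con 2 :+ p)) refl p)

    e-nonsquare : ∀ j → ¬ IsSquare (en j)
    e-nonsquare j with Pn j * Pn j | P²≡suc j
    ... | _ | Q , refl = nonsquare-between (suc (suc Q)) (3 + Q) (m<m+n _ (s≤s z≤n))
      (solve 1 (λ q → (con 1 :+ ((con 2 :+ q) :* (con 2 :+ q) :+ (con 1 :+ q))) :+ (con 3 :+ q)
                        := (con 3 :+ q) :* (con 3 :+ q)) refl Q)

    d⊥P : ∀ j → Coprime (dn j) (Pn j)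
    d⊥P j {i} (i∣d , i∣P) = ∣1⇒≡1 (∣m+n∣m⇒∣n {m = Pn j * Pn j} (subst (i ∣_) (+-comm 1 (Pn j * Pn j)) i∣d) (∣m⇒∣m*n (Pn j) i∣P))

    e⊥d : ∀ j → Coprime (en j) (dn j)
    e⊥d j = suc≡multiple⇒coprime (trans (suc-e j) (*-comm (Pn j * Pn j) (dn j)))

    e⊥P : ∀ j → Coprime (en j) (Pn j)
    e⊥P j = suc≡multiple⇒coprime {c = Pn j * dn j} (trans (suc-e j) (*-assoc (Pn j) (Pn j) (dn j)))

    w⊥P : ∀ j → Coprime (wn j) (Pn j)
    w⊥P j = Coprimality.sym (coprime-* (Coprimality.sym (d⊥P j)) (Coprimality.sym (e⊥P j)))

    P∣P : ∀ {i j} → i ℕ.≤′ j → Pn i ∣ Pn j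
    P∣P ℕ.≤′-refl       = ∣-refl
    P∣P (ℕ.≤′-step i≤j) = ∣m⇒∣m*n _ (P∣P i≤j)

    -- For i < j the factor `wn i` is already absorbed into `Pn j`, to which `wn j` is coprime.
    w⊥w-< : ∀ {i j} → i < j → Coprime (wn j) (wn i)
    w⊥w-< {i} {j} i<j = coprime-∣ (∣-trans (n∣m*n (Pn i)) (P∣P (≤⇒≤′ i<j))) (w⊥P j)

    w⊥w : ∀ {i j} → i ≢ j → Coprime (wn i) (wn j)
    w⊥w {i} {j} i≢j with <-cmp i j
    ... | tri< i<j _ _ = Coprimality.sym (w⊥w-< i<j)
    ... | tri≈ _ i≡j _ = contradiction i≡j i≢j
    ... | tri> _ _ j<i = w⊥w-< j<i

    d≢0 : ∀ j → dn j ≢ 0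
    d≢0 j ()

    w≡d*e : ∀ j → wn j ≡ dn j * en j
    w≡d*e j = refl

  d∣w : ∀ j → dn j ∣ wn j
  d∣w j = subst (dn j ∣_) (sym (w≡d*e j)) (m∣m*n (en j))

  e∣w : ∀ j → en j ∣ wn j
  e∣w j = subst (en j ∣_) (sym (w≡d*e j)) (n∣m*n (dn j))

  Πw : List ℕ → ℕ
  Πw []       = 1
  Πw (j ∷ js) = Πw js * wn j

  w⊥Πw : ∀ {i js} → All (i ≢_) js → Coprime (wn i) (Πw js)
  w⊥Πw []            (_ , k∣1) = ∣1⇒≡1 k∣1
  w⊥Πw (i≢j ∷ i∉js) = coprime-* (w⊥Πw i∉js) (w⊥w i≢j)

  module _ {i js m} (i∉js : All (i ≢_) js) (m∣Π : m ∣ Πw js) where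
    d⊥m : Coprime (dn i) m
    d⊥m = coprime-∣ m∣Π (Coprimality.sym (coprime-∣ (d∣w i) (Coprimality.sym (w⊥Πw i∉js))))

    e⊥m : Coprime (en i) m
    e⊥m = coprime-∣ m∣Π (Coprimality.sym (coprime-∣ (e∣w i) (Coprimality.sym (w⊥Πw i∉js))))

    dm-nonsquare : ¬ IsSquare (dn i * m)
    dm-nonsquare = d-nonsquare i ∘ coprime-factor-square d⊥m

    -- As w = d e, the factor to split off is e: it is coprime to d m, and to d² m in
    -- `wdm-nonsquare`, and is not a square itself.
    wm-nonsquare : ¬ IsSquare (wn i * m)
    wm-nonsquare = e-nonsquare i ∘ coprime-factor-square (coprime-* (e⊥d i) e⊥m) ∘
      subst IsSquare (trans (cong (_* m) (w≡d*e i)) (solve 3 (λ d e m → d :* e :* m := e :* (d :* m)) refl (dn i) (en i) m))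

    wdm-nonsquare : ¬ IsSquare (wn i * dn i * m)
    wdm-nonsquare = e-nonsquare i ∘ coprime-factor-square (coprime-* (e⊥d i) (coprime-* (e⊥d i) e⊥m)) ∘
      subst IsSquare (trans (cong (λ w → w * dn i * m) (w≡d*e i)) (solve 3 (λ d e m → d :* e :* d :* m := e :* (d :* (d :* m))) refl (dn i) (en i) m))

open Parameters

-- Integers that are squares of rationals

module IntegersInℚ where
  open ≡ using (refl; sym; trans; cong; module ≡-Reasoning)

  -- Built by `mkℚ` so that the numerator computes to `z`; injectivity of the embedding is then read
  -- off from numerators.
  fromℤ : ℤ → ℚ
  fromℤ z = mkℚ z 0 (Coprimality.sym (1-coprimeTo ∣ z ∣))

  fromℤ-+ : ∀ x y → fromℤ (x ℤ.+ y) ≡ fromℤ x ℚ.+ fromℤ y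
  fromℤ-+ x y = ℚ.toℚᵘ-injective (ℚᵘ.≃-trans
    (*≡* (solve 2 (λ a b → (a :+ b) :* con ℤ.1ℤ := (a :* con ℤ.1ℤ :+ b :* con ℤ.1ℤ) :* con ℤ.1ℤ) refl x y))
    (ℚᵘ.≃-sym (ℚ.toℚᵘ-homo-+ (fromℤ x) (fromℤ y))))
    where open ℤ-Solver

  fromℤ-* : ∀ x y → fromℤ (x ℤ.* y) ≡ fromℤ x ℚ.* fromℤ y
  fromℤ-* x y = ℚ.toℚᵘ-injective (ℚᵘ.≃-trans (*≡* refl) (ℚᵘ.≃-sym (ℚ.toℚᵘ-homo-* (fromℤ x) (fromℤ y))))

  fromℤ-neg : ∀ x → fromℤ (ℤ.- x) ≡ ℚ.- fromℤ x
  fromℤ-neg x = ℚ.toℚᵘ-injective (ℚᵘ.≃-trans (*≡* refl) (ℚᵘ.≃-sym (ℚ.toℚᵘ-homo‿- (fromℤ x))))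

  -- In lowest terms, a² = n b² makes b divide a², and coprimality of a and b leaves b = 1.
  rational-square⇒IsSquare : ∀ q {n} → q ℚ.* q ≡ fromℤ (+ n) → IsSquare n
  rational-square⇒IsSquare q@(mkℚ a b-1 prf) {n} q²≡n = ∣ a ∣ , (begin
    ∣ a ∣ ℕ.* ∣ a ∣        ≡⟨ a²≡nb² ⟩
    n ℕ.* (b ℕ.* b)        ≡⟨ cong (λ b → n ℕ.* (b ℕ.* b)) b≡1 ⟩
    n ℕ.* 1                ≡⟨ ℕ.*-identityʳ n ⟩
    n                      ∎)
    where
    open ≡-Reasoning
    b = suc b-1

    cross : toℚᵘ q ℚᵘ.* toℚᵘ q ℚᵘ.≃ mkℚᵘ (+ n) 0
    cross = ℚᵘ.≃-trans (ℚᵘ.≃-sym (ℚ.toℚᵘ-homo-* q q)) (ℚᵘ.≃-reflexive (cong toℚᵘ q²≡n))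

    a²≡nb² : ∣ a ∣ ℕ.* ∣ a ∣ ≡ n ℕ.* (b ℕ.* b)
    a²≡nb² with cross
    ... | *≡* eq = begin
      ∣ a ∣ ℕ.* ∣ a ∣              ≡⟨ ℤ.abs-* a a ⟨
      ∣ a ℤ.* a ∣                  ≡⟨ cong ∣_∣ (ℤ.*-identityʳ (a ℤ.* a)) ⟨
      ∣ a ℤ.* a ℤ.* ℤ.1ℤ ∣         ≡⟨ cong ∣_∣ eq ⟩
      ∣ + n ℤ.* (+ (b ℕ.* b)) ∣    ≡⟨ ℤ.abs-* (+ n) (+ (b ℕ.* b)) ⟩
      n ℕ.* (b ℕ.* b)              ∎

    a⊥b : Coprime ∣ a ∣ b
    a⊥b = Coprimality.recompute prf

    b≡1 : b ≡ 1
    b≡1 = a⊥b (coprime-divisor (Coprimality.sym a⊥b) b∣a² , ∣-refl)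
      where
      b∣a² : b ∣ ∣ a ∣ ℕ.* ∣ a ∣
      b∣a² = divides (n ℕ.* b) (trans a²≡nb² (sym (ℕ.*-assoc n b b)))

open IntegersInℚ

-- Decidable equality and arithmetic in the closure

module Closure {c ℓ₁ ℓ₂ : Level} (ℚ̄ : AlgebraicClosure c ℓ₁ ℓ₂) where


  open AlgebraicClosure ℚ̄ public hiding (zero)
  open CommutativeRing commutativeRing public using (ring; *-commutativeSemigroup)
  open RingProperties ring public using (-0#≈0#)
  open RingMorphisms.IsRingHomomorphism ι-isHomomorphism public
    using (+-homo; *-homo; -‿homo; 0#-homo; 1#-homo)
  module ≈-Reasoning = SetoidReasoning setoid
  open ≈-Reasoning public

  ψ : ℤ → Carrier
  ψ z = ι (fromℤ z)

  ν : ℕ → Carrier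
  ν n = ψ (+ n)

  ι-cong : ∀ {p q} → p ≡ q → ι p ≈ ι q
  ι-cong = reflexive ∘ ≡.cong ι

  ψ-morphism : ℤ.+-*-rawRing -Raw-AlmostCommutative⟶ fromCommutativeRing commutativeRing
  ψ-morphism = record
    { ⟦_⟧    = ψ
    ; +-homo = λ x y → trans (ι-cong (fromℤ-+ x y)) (+-homo _ _)
    ; *-homo = λ x y → trans (ι-cong (fromℤ-* x y)) (*-homo _ _)
    ; -‿homo = λ x → trans (ι-cong (fromℤ-neg x)) (-‿homo _)
    ; 0-homo = 0#-homo
    ; 1-homo = 1#-homo
    }

  module Solver = RingSolver ℤ.+-*-rawRing (fromCommutativeRing commutativeRing) ψ-morphism
    (λ x y → Maybe.map (ι-cong ∘ ≡.cong fromℤ) (dec⇒maybe (x ℤ.≟ y)))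
  open Solver public using (solve; _:=_; _:+_; _:*_; _:-_; :-_; con)

  ν-* : ∀ m n → ν (m ℕ.* n) ≈ ν m * ν n
  ν-* m n = trans (ι-cong (≡.cong fromℤ (ℤ.pos-* m n))) (_-Raw-AlmostCommutative⟶_.*-homo ψ-morphism (+ m) (+ n))

  ν-+ : ∀ m n → ν (m ℕ.+ n) ≈ ν m + ν n
  ν-+ m n = _-Raw-AlmostCommutative⟶_.+-homo ψ-morphism (+ m) (+ n)

  x-0≈x : ∀ x → x - 0# ≈ x
  x-0≈x x = trans (+-congˡ -0#≈0#) (+-identityʳ x)

  x-y≈0⇒x≈y : ∀ {x y} → x - y ≈ 0# → x ≈ y
  x-y≈0⇒x≈y {x} {y} eq = begin
    x            ≈⟨ solve 2 (λ x y → x := (x :- y) :+ y) refl x y ⟩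
    (x - y) + y  ≈⟨ +-congʳ eq ⟩
    0# + y       ≈⟨ +-identityˡ y ⟩
    y            ∎

  x≈y⇒x-y≈0 : ∀ {x y} → x ≈ y → x - y ≈ 0#
  x≈y⇒x-y≈0 {x} {y} eq = trans (+-congʳ eq) (-‿inverseʳ y)

  invertible⇒#0 : ∀ {x y} → x * y ≈ 1# → x # 0#
  invertible⇒#0 {x} {y} xy≈1 =
    invertible⇒# (y , trans (*-congˡ (x-0≈x x)) (trans (*-comm y x) xy≈1) , trans (*-congʳ (x-0≈x x)) xy≈1)

  #0⇒invertible : ∀ {x} → x # 0# → ∃ λ y → x * y ≈ 1#
  #0⇒invertible {x} x#0 with #⇒invertible x#0
  ... | y , _ , eq = y , trans (*-congʳ (sym (x-0≈x x))) eq

  1#0 : 1# # 0#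
  1#0 = invertible⇒#0 (*-identityˡ 1#)

  *-#0 : ∀ {x y} → x # 0# → y # 0# → x * y # 0#
  *-#0 {x} {y} x#0 y#0 with #0⇒invertible x#0 | #0⇒invertible y#0
  ... | x' , xx'≈1 | y' , yy'≈1 = invertible⇒#0 {y = x' * y'} (begin
    (x * y) * (x' * y')   ≈⟨ solve 4 (λ x y x' y' → (x :* y) :* (x' :* y') := (x :* x') :* (y :* y')) refl x y x' y' ⟩
    (x * x') * (y * y')   ≈⟨ *-cong xx'≈1 yy'≈1 ⟩
    1# * 1#               ≈⟨ *-identityˡ 1# ⟩
    1#                    ∎)

  ι-#0 : ∀ {q} → q ≢ 0ℚ → ι q # 0#
  ι-#0 {q} q≢0 = invertible⇒#0 {y = ι (ℚ.1/ q)} (begin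
    ι q * ι (ℚ.1/ q)    ≈⟨ *-homo q (ℚ.1/ q) ⟨
    ι (q ℚ.* ℚ.1/ q)    ≈⟨ ι-cong (ℚ.*-inverseʳ q) ⟩
    ι 1ℚ                ≈⟨ 1#-homo ⟩
    1#                  ∎)
    where instance
      _ = ℚ.≢-nonZero q≢0

  #-resp : ∀ {x y} → x ≈ y → x # 0# → y # 0#
  #-resp x≈y x#0 with #0⇒invertible x#0
  ... | z , eq = invertible⇒#0 (trans (*-congʳ (sym x≈y)) eq)

  #⇒-#0 : ∀ {x y} → x # y → x - y # 0#
  #⇒-#0 {x} {y} x#y with #⇒invertible x#y
  ... | z , _ , eq = invertible⇒#0 eq

  infix 9 _⟨_⟩
  _⟨_⟩ : ℚ[X] → Carrier → Carrier
  p ⟨ x ⟩ = eval (map ι p) x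

  -- Cotransitivity is applied at the lowest nonzero coefficient a. Write p = Xⁱ (a + X h): either a
  -- is apart from the value of a + X h, and then x h(x), hence x, is apart from 0; or that value is
  -- apart from 0, and so is p(x) as soon as x is.
  nonzero-coefficient⇒ : ∀ p n → coeffℚ p n ≢ 0ℚ → ∀ x → x # 0# ⊎ (x # 0# → p ⟨ x ⟩ # 0#)
  nonzero-coefficient⇒ []      n       a≢0 x = contradiction ≡.refl a≢0
  nonzero-coefficient⇒ (a ∷ p) zero    a≢0 x with #-cotrans (ι-#0 a≢0) ((a ∷ p) ⟨ x ⟩)
  ... | inj₂ px#0 = inj₂ λ _ → px#0
  ... | inj₁ a#px with #0⇒invertible (#⇒-#0 (#-sym a#px))
  ...   | z , eq = inj₁ (invertible⇒#0 {y = p ⟨ x ⟩ * z} (begin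
    x * (p ⟨ x ⟩ * z)                 ≈⟨ solve 4 (λ a x p z → x :* (p :* z) := ((a :+ x :* p) :- a) :* z) refl (ι a) x (p ⟨ x ⟩) z ⟩
    ((a ∷ p) ⟨ x ⟩ - ι a) * z         ≈⟨ eq ⟩
    1#                                ∎))
  nonzero-coefficient⇒ (a ∷ p) (suc n) aₙ≢0 x with a ℚ.≟ 0ℚ
  ... | no a≢0 = nonzero-coefficient⇒ (a ∷ p) zero a≢0 x
  ... | yes ≡.refl with nonzero-coefficient⇒ p n aₙ≢0 x
  ...   | inj₁ x#0 = inj₁ x#0
  ...   | inj₂ f   = inj₂ λ x#0 → #-resp (sym (trans (+-congʳ 0#-homo) (+-identityˡ _))) (*-#0 x#0 (f x#0))

  abstract
    -- Algebraicity makes the apartness decidable. For p(x) = 0 the second alternative of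
    -- `nonzero-coefficient⇒` refutes x # 0, and tightness turns this into x ≈ 0.
    ≈0⊎#0 : ∀ x → x ≈ 0# ⊎ x # 0#
    ≈0⊎#0 x with algebraic x
    ... | p , (d , p_d≢0 , _) , px≈0 with nonzero-coefficient⇒ p d p_d≢0 x
    ...   | inj₁ x#0 = inj₂ x#0
    ...   | inj₂ f   = inj₁ (proj₁ (tight x 0#) λ x#0 → #-irrefl px≈0 (f x#0))

  _≈?_ : ∀ x y → Dec (x ≈ y)
  x ≈? y with ≈0⊎#0 (x - y)
  ... | inj₁ eq  = yes (x-y≈0⇒x≈y eq)
  ... | inj₂ x#y = no λ x≈y → #-irrefl (x≈y⇒x-y≈0 x≈y) x#y

  ≉0⇒#0 : ∀ {x} → ¬ x ≈ 0# → x # 0#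
  ≉0⇒#0 {x} x≉0 with ≈0⊎#0 x
  ... | inj₁ x≈0 = contradiction x≈0 x≉0
  ... | inj₂ x#0 = x#0

  abstract
    inverse : ∀ {x} → ¬ x ≈ 0# → ∃ λ y → x * y ≈ 1#
    inverse = #0⇒invertible ∘ ≉0⇒#0

  1≉0 : ¬ 1# ≈ 0#
  1≉0 eq = #-irrefl eq 1#0

  *-≉0 : ∀ {x y} → ¬ x ≈ 0# → ¬ y ≈ 0# → ¬ x * y ≈ 0#
  *-≉0 x≉0 y≉0 eq = #-irrefl eq (*-#0 (≉0⇒#0 x≉0) (≉0⇒#0 y≉0))

  zero-product : ∀ {x y} → x * y ≈ 0# → x ≈ 0# ⊎ y ≈ 0#
  zero-product {x} {y} xy≈0 with x ≈? 0# | y ≈? 0#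
  ... | yes x≈0 | _       = inj₁ x≈0
  ... | no _    | yes y≈0 = inj₂ y≈0
  ... | no x≉0  | no y≉0  = contradiction xy≈0 (*-≉0 x≉0 y≉0)

  *-cancelˡ-≈ : ∀ {x y z} → ¬ x ≈ 0# → x * y ≈ x * z → y ≈ z
  *-cancelˡ-≈ {x} {y} {z} x≉0 eq with zero-product (trans
    (solve 3 (λ x y z → x :* (y :- z) := x :* y :- x :* z) refl x y z) (x≈y⇒x-y≈0 eq))
  ... | inj₁ x≈0   = contradiction x≈0 x≉0
  ... | inj₂ y-z≈0 = x-y≈0⇒x≈y y-z≈0

  equal-squares : ∀ {x y} → x * x ≈ y * y → x ≈ y ⊎ x ≈ - y
  equal-squares {x} {y} eq with zero-product (trans
    (solve 2 (λ x y → (x :- y) :* (x :+ y) := x :* x :- y :* y) refl x y) (x≈y⇒x-y≈0 eq))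
  ... | inj₁ x-y≈0 = inj₁ (x-y≈0⇒x≈y x-y≈0)
  ... | inj₂ x+y≈0 = inj₂ (x-y≈0⇒x≈y (trans (solve 2 (λ x y → x :- (:- y) := x :+ y) refl x y) x+y≈0))

  ι-injective : ∀ {q} → ι q ≈ 0# → q ≡ 0ℚ
  ι-injective {q} eq with q ℚ.≟ 0ℚ
  ... | yes q≡0 = q≡0
  ... | no q≢0  = contradiction (ι-#0 q≢0) (#-irrefl eq)

  ν-≉0 : ∀ {n} → n ≢ 0 → ¬ ν n ≈ 0#
  ν-≉0 n≢0 eq = n≢0 (ℤ.+-injective (≡.cong ℚ.ℚ.numerator (ι-injective eq)))

  x+x≈0⇒x≈0 : ∀ {x} → x + x ≈ 0# → x ≈ 0#
  x+x≈0⇒x≈0 {x} eq with zero-product (trans (solve 1 (λ x → con (+ 2) :* x := x :+ x) refl x) eq)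
  ... | inj₁ 2≈0 = contradiction 2≈0 (ν-≉0 λ ())
  ... | inj₂ x≈0 = x≈0

  abstract
    square-root : ∀ a → ∃ λ x → x * x ≈ a
    square-root a with algebraicallyClosed (- a ∷ 0# ∷ 1# ∷ []) 1
      (1≉0 , λ { (suc (suc (suc _))) _ → refl ; (suc zero) (ℕ.s≤s ()) ; (suc (suc zero)) (ℕ.s≤s (ℕ.s≤s ())) })
    ... | x , eq = x , x-y≈0⇒x≈y (trans (begin
      x * x - a                                ≈⟨ +-congʳ (*-congˡ (*-identityʳ x)) ⟨
      x * (x * 1#) - a                         ≈⟨ solve 3 (λ x a o → x :* (x :* o) :- a := (:- a) :+ x :* (x :* o)) refl x a 1# ⟩
      - a + x * (x * 1#)                       ≈⟨ +-congˡ (*-congˡ (trans (+-identityˡ _) (*-congˡ (trans (+-congˡ (zeroʳ x)) (+-identityʳ 1#))))) ⟨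
      - a + x * (0# + x * (1# + x * 0#))       ∎) eq)

  open Polynomials commutativeRing using (coeff)

  ι-injective₂ : ∀ {p q} → ι p ≈ ι q → p ≡ q
  ι-injective₂ {p} {q} eq = p-q≡0⇒p≡q p q (ι-injective (begin
    ι (p ℚ.- q)       ≈⟨ +-homo p (ℚ.- q) ⟩
    ι p + ι (ℚ.- q)   ≈⟨ +-congˡ (-‿homo q) ⟩
    ι p - ι q         ≈⟨ x≈y⇒x-y≈0 eq ⟩
    0#                ∎))

  ν-injective : ∀ {m n} → ν m ≈ ν n → m ≡ n
  ν-injective eq = ℤ.+-injective (≡.cong ℚ.ℚ.numerator (ι-injective₂ eq))

  -- Evaluation of rational polynomials in the closure

  scale : ℚ → ℚ[X] → ℚ[X]
  scale q = map (q ℚ.*_)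

  negₚ : ℚ[X] → ℚ[X]
  negₚ = map (ℚ.-_)

  shiftₚ : ℚ[X] → ℚ[X]
  shiftₚ p = 0ℚ ∷ p

  ev-scale : ∀ q p x → scale q p ⟨ x ⟩ ≈ ι q * p ⟨ x ⟩
  ev-scale q []      x = sym (zeroʳ (ι q))
  ev-scale q (a ∷ p) x = begin
    ι (q ℚ.* a) + x * scale q p ⟨ x ⟩    ≈⟨ +-cong (*-homo q a) (*-congˡ (ev-scale q p x)) ⟩
    ι q * ι a + x * (ι q * p ⟨ x ⟩)      ≈⟨ solve 4 (λ q a x p → q :* a :+ x :* (q :* p) := q :* (a :+ x :* p)) refl (ι q) (ι a) x (p ⟨ x ⟩) ⟩
    ι q * (ι a + x * p ⟨ x ⟩)            ∎

  ev-neg : ∀ p x → negₚ p ⟨ x ⟩ ≈ - p ⟨ x ⟩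
  ev-neg []      x = sym -0#≈0#
  ev-neg (a ∷ p) x = begin
    ι (ℚ.- a) + x * negₚ p ⟨ x ⟩   ≈⟨ +-cong (-‿homo a) (*-congˡ (ev-neg p x)) ⟩
    - ι a + x * - p ⟨ x ⟩          ≈⟨ solve 3 (λ a x p → :- a :+ x :* :- p := :- (a :+ x :* p)) refl (ι a) x (p ⟨ x ⟩) ⟩
    - (ι a + x * p ⟨ x ⟩)          ∎

  ev-shift : ∀ p x → shiftₚ p ⟨ x ⟩ ≈ x * p ⟨ x ⟩
  ev-shift p x = trans (+-congʳ 0#-homo) (+-identityˡ _)

  ev-+ : ∀ p q x → (p +ₚ q) ⟨ x ⟩ ≈ p ⟨ x ⟩ + q ⟨ x ⟩
  ev-+ []      q       x = sym (+-identityˡ _)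
  ev-+ (a ∷ p) []      x = sym (+-identityʳ _)
  ev-+ (a ∷ p) (b ∷ q) x = begin
    ι (a ℚ.+ b) + x * (p +ₚ q) ⟨ x ⟩                 ≈⟨ +-cong (+-homo a b) (*-congˡ (ev-+ p q x)) ⟩
    ι a + ι b + x * (p ⟨ x ⟩ + q ⟨ x ⟩)              ≈⟨ solve 5 (λ a b x p q → a :+ b :+ x :* (p :+ q) := (a :+ x :* p) :+ (b :+ x :* q)) refl (ι a) (ι b) x (p ⟨ x ⟩) (q ⟨ x ⟩) ⟩
    (ι a + x * p ⟨ x ⟩) + (ι b + x * q ⟨ x ⟩)        ∎

  ev-* : ∀ p q x → (p *ₚ q) ⟨ x ⟩ ≈ p ⟨ x ⟩ * q ⟨ x ⟩
  ev-* []      q x = sym (zeroˡ _)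
  ev-* (a ∷ p) q x = begin
    (scale a q +ₚ shiftₚ (p *ₚ q)) ⟨ x ⟩           ≈⟨ ev-+ (scale a q) (shiftₚ (p *ₚ q)) x ⟩
    scale a q ⟨ x ⟩ + shiftₚ (p *ₚ q) ⟨ x ⟩        ≈⟨ +-cong (ev-scale a q x) (trans (ev-shift (p *ₚ q) x) (*-congˡ (ev-* p q x))) ⟩
    ι a * q ⟨ x ⟩ + x * (p ⟨ x ⟩ * q ⟨ x ⟩)        ≈⟨ solve 4 (λ a x p q → a :* q :+ x :* (p :* q) := (a :+ x :* p) :* q) refl (ι a) x (p ⟨ x ⟩) (q ⟨ x ⟩) ⟩
    (ι a + x * p ⟨ x ⟩) * q ⟨ x ⟩                  ∎

  ev-0 : ∀ p → p ≈ₚ [] → ∀ x → p ⟨ x ⟩ ≈ 0#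
  ev-0 []      p≈0 x = refl
  ev-0 (a ∷ p) p≈0 x = begin
    ι a + x * p ⟨ x ⟩   ≈⟨ +-cong (trans (ι-cong (p≈0 0)) 0#-homo) (*-congˡ (ev-0 p (p≈0 ∘ suc) x)) ⟩
    0# + x * 0#         ≈⟨ trans (+-identityˡ _) (zeroʳ x) ⟩
    0#                  ∎

  ev-≈ₚ : ∀ p q → p ≈ₚ q → ∀ x → p ⟨ x ⟩ ≈ q ⟨ x ⟩
  ev-≈ₚ []      q       p≈q x = sym (ev-0 q (≡.sym ∘ p≈q) x)
  ev-≈ₚ (a ∷ p) []      p≈q x = ev-0 (a ∷ p) p≈q x
  ev-≈ₚ (a ∷ p) (b ∷ q) p≈q x = +-cong (ι-cong (p≈q 0)) (*-congˡ (ev-≈ₚ p q (p≈q ∘ suc) x))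

  eval-cong : ∀ p {x y} → x ≈ y → eval p x ≈ eval p y
  eval-cong []      x≈y = refl
  eval-cong (a ∷ p) x≈y = +-congˡ (*-cong x≈y (eval-cong p x≈y))

  ev-cong : ∀ p {x y} → x ≈ y → p ⟨ x ⟩ ≈ p ⟨ y ⟩
  ev-cong p = eval-cong (map ι p)

  dilate : ℚ → ℚ[X] → ℚ[X]
  dilate q []      = []
  dilate q (a ∷ p) = a ∷ scale q (dilate q p)

  ev-dilate : ∀ q p x → dilate q p ⟨ x ⟩ ≈ p ⟨ ι q * x ⟩
  ev-dilate q []      x = refl
  ev-dilate q (a ∷ p) x = +-congˡ (begin
    x * scale q (dilate q p) ⟨ x ⟩   ≈⟨ *-congˡ (trans (ev-scale q (dilate q p) x) (*-congˡ (ev-dilate q p x))) ⟩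
    x * (ι q * p ⟨ ι q * x ⟩)        ≈⟨ solve 3 (λ x q p → x :* (q :* p) := q :* x :* p) refl x (ι q) (p ⟨ ι q * x ⟩) ⟩
    ι q * x * p ⟨ ι q * x ⟩          ∎)

  coeff-scale : ∀ q p i → coeffℚ (scale q p) i ≡ q ℚ.* coeffℚ p i
  coeff-scale q []      i       = ≡.sym (ℚ.*-zeroʳ q)
  coeff-scale q (a ∷ p) zero    = ≡.refl
  coeff-scale q (a ∷ p) (suc i) = coeff-scale q p i

  coeff-+ : ∀ p q i → coeffℚ (p +ₚ q) i ≡ coeffℚ p i ℚ.+ coeffℚ q i
  coeff-+ []      q       i       = ≡.sym (ℚ.+-identityˡ _)
  coeff-+ (a ∷ p) []      i       = ≡.sym (ℚ.+-identityʳ _)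
  coeff-+ (a ∷ p) (b ∷ q) zero    = ≡.refl
  coeff-+ (a ∷ p) (b ∷ q) (suc i) = coeff-+ p q i

  coeff-map-ι : ∀ p i → coeff (map ι p) i ≈ ι (coeffℚ p i)
  coeff-map-ι []      i       = sym 0#-homo
  coeff-map-ι (a ∷ p) zero    = refl
  coeff-map-ι (a ∷ p) (suc i) = coeff-map-ι p i

  degree? : ∀ p → p ≈ₚ [] ⊎ ∃ (HasDegreeℚ p)
  degree? []      = inj₁ λ _ → ≡.refl
  degree? (a ∷ p) with degree? p
  ... | inj₂ (d , pd≢0 , high) = inj₂ (suc d , pd≢0 , λ { (suc i) (ℕ.s≤s d<i) → high i d<i })
  ... | inj₁ p≈0 with a ℚ.≟ 0ℚ
  ...   | yes a≡0 = inj₁ λ { zero → a≡0 ; (suc i) → p≈0 i }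
  ...   | no  a≢0 = inj₂ (0 , a≢0 , λ { (suc i) _ → p≈0 i })

  p*q≢0 : ∀ {p q} → p ≢ 0ℚ → q ≢ 0ℚ → p ℚ.* q ≢ 0ℚ
  p*q≢0 {p} {q} p≢0 q≢0 pq≡0 = #-irrefl
    (trans (sym (*-homo p q)) (trans (ι-cong pq≡0) 0#-homo)) (*-#0 (ι-#0 p≢0) (ι-#0 q≢0))

  dilate-≈0 : ∀ q p i → coeffℚ p i ≡ 0ℚ → coeffℚ (dilate q p) i ≡ 0ℚ
  dilate-≈0 q []      i       eq = ≡.refl
  dilate-≈0 q (a ∷ p) zero    eq = eq
  dilate-≈0 q (a ∷ p) (suc i) eq = ≡.trans (coeff-scale q (dilate q p) i)
    (≡.trans (≡.cong (q ℚ.*_) (dilate-≈0 q p i eq)) (ℚ.*-zeroʳ q))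

  dilate-≢0 : ∀ {q} → q ≢ 0ℚ → ∀ p i → coeffℚ p i ≢ 0ℚ → coeffℚ (dilate q p) i ≢ 0ℚ
  dilate-≢0 q≢0 []      i       ne = ne
  dilate-≢0 q≢0 (a ∷ p) zero    ne = ne
  dilate-≢0 {q} q≢0 (a ∷ p) (suc i) ne = ≡.subst (_≢ 0ℚ) (≡.sym (coeff-scale q (dilate q p) i))
    (p*q≢0 q≢0 (dilate-≢0 q≢0 p i ne))

  dilate-degree : ∀ {q} → q ≢ 0ℚ → ∀ p {d} → HasDegreeℚ p d → HasDegreeℚ (dilate q p) d
  dilate-degree {q} q≢0 p {d} (pd≢0 , high) = dilate-≢0 q≢0 p d pd≢0 , λ i d<i → dilate-≈0 q p i (high i d<i)

  nonconstant⇒root : ∀ p {d} → HasDegreeℚ p (suc d) → ∃ λ x → p ⟨ x ⟩ ≈ 0#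
  nonconstant⇒root p {d} (pd≢0 , high) = algebraicallyClosed (map ι p) d
    ( (λ eq → pd≢0 (ι-injective (trans (sym (coeff-map-ι p (suc d))) eq)))
    , λ i d<i → trans (coeff-map-ι p i) (trans (ι-cong (high i d<i)) 0#-homo))

  constant⇒unit : ∀ p → HasDegreeℚ p 0 → ∃ λ q → (q *ₚ p) ≈ₚ (1ℚ ∷ [])
  constant⇒unit p (p0≢0 , high) = 1/p0 ∷ [] , unit
    where
    instance
      _ = ℚ.≢-nonZero p0≢0
    1/p0 = ℚ.1/ coeffℚ p 0

    unit : ((1/p0 ∷ []) *ₚ p) ≈ₚ (1ℚ ∷ [])
    unit i = ≡.trans (coeff-+ (scale 1/p0 p) (0ℚ ∷ []) i)
      (≡.trans (≡.cong₂ ℚ._+_ (coeff-scale 1/p0 p i) (coeff-0 i)) (≡.trans (ℚ.+-identityʳ _) (lemma i)))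
      where
      coeff-0 : ∀ i → coeffℚ (0ℚ ∷ []) i ≡ 0ℚ
      coeff-0 zero    = ≡.refl
      coeff-0 (suc i) = ≡.refl
      lemma : ∀ i → 1/p0 ℚ.* coeffℚ p i ≡ coeffℚ (1ℚ ∷ []) i
      lemma zero    = ℚ.*-inverseˡ (coeffℚ p 0)
      lemma (suc i) = ≡.trans (≡.cong (1/p0 ℚ.*_) (high (suc i) (ℕ.s≤s ℕ.z≤n))) (ℚ.*-zeroʳ 1/p0)

  -- Roots of polynomials over the closure

  -- Synthetic division by X - y. The length equation says that the quotient is one entry shorter
  -- than `a ∷ p`, which is the measure for `infinitely-many-roots⇒≈0`.
  factor : ∀ (a : Carrier) p y → ∃ λ q → length q ≡ length p ×
             (∀ x → eval (a ∷ p) x ≈ eval (a ∷ p) y + (x - y) * eval q x)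
  factor a []      y = [] , ≡.refl , λ x → begin
    a + x * 0#                       ≈⟨ +-congˡ (trans (zeroʳ x) (sym (zeroʳ y))) ⟩
    a + y * 0#                       ≈⟨ +-identityʳ _ ⟨
    a + y * 0# + 0#                  ≈⟨ +-congˡ (zeroʳ (x - y)) ⟨
    a + y * 0# + (x - y) * 0#        ∎
  factor a (b ∷ p) y with factor b p y
  ... | q , len , eq = eval (b ∷ p) y ∷ q , ≡.cong suc len , λ x → begin
    a + x * eval (b ∷ p) x                                           ≈⟨ +-congˡ (*-congˡ (eq x)) ⟩
    a + x * (eval (b ∷ p) y + (x - y) * eval q x)                    ≈⟨ solve 5 (λ a x y e q → a :+ x :* (e :+ (x :- y) :* q) := (a :+ y :* e) :+ (x :- y) :* (e :+ x :* q)) refl a x y (eval (b ∷ p) y) (eval q x) ⟩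
    a + y * eval (b ∷ p) y + (x - y) * (eval (b ∷ p) y + x * eval q x) ∎

  root-factor : ∀ p {y} → eval p y ≈ 0# → ∃ λ q → ∀ x → eval p x ≈ (x - y) * eval q x
  root-factor []      {y} _    = [] , λ x → sym (zeroʳ (x - y))
  root-factor (a ∷ p) {y} py≈0 with factor a p y
  ... | q , _ , eq = q , λ x → trans (eq x) (trans (+-congʳ py≈0) (+-identityˡ _))

  -- Trailing zeros make the length of a list no measure of degree, but an infinite supply of roots
  -- does not care: each root divided out shortens the list, and the rest of the sequence are roots
  -- of the quotient.
  infinitely-many-roots⇒≈0 : ∀ p (ys : ℕ → Carrier) → (∀ {i j} → i ≢ j → ¬ ys i ≈ ys j) →
                             (∀ i → eval p (ys i) ≈ 0#) → ∀ x → eval p x ≈ 0#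
  infinitely-many-roots⇒≈0 p = go (length p) p ≡.refl
    where
    go : ∀ n p → length p ≡ n → (ys : ℕ → Carrier) → (∀ {i j} → i ≢ j → ¬ ys i ≈ ys j) →
         (∀ i → eval p (ys i) ≈ 0#) → ∀ x → eval p x ≈ 0#
    go n       []      _   ys distinct zeros x = refl
    go (suc n) (a ∷ p) len ys distinct zeros x with factor a p (ys 0)
    ... | q , len′ , eq = begin
      eval (a ∷ p) x                                    ≈⟨ eq x ⟩
      eval (a ∷ p) (ys 0) + (x - ys 0) * eval q x       ≈⟨ +-cong (zeros 0) (*-congˡ (go n q (≡.trans len′ (ℕ.suc-injective len)) (ys ∘ suc) (λ i≢j → distinct (i≢j ∘ ℕ.suc-injective)) zeros′ x)) ⟩
      0# + (x - ys 0) * 0#                              ≈⟨ trans (+-identityˡ _) (zeroʳ _) ⟩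
      0#                                                ∎
      where
      zeros′ : ∀ i → eval q (ys (suc i)) ≈ 0#
      zeros′ i with zero-product (trans (sym (+-identityˡ _)) (trans (+-congʳ (sym (zeros 0))) (trans (sym (eq (ys (suc i)))) (zeros (suc i)))))
      ... | inj₁ same = contradiction (x-y≈0⇒x≈y same) (distinct λ ())
      ... | inj₂ q≈0  = q≈0

  -- In characteristic 0 the points y + 1, y + 2, ... are distinct and avoid y. This extends
  -- identities to the point at which a factor z - y could not be cancelled.
  ≈0-off-a-point : ∀ p y → (∀ x → ¬ x ≈ y → eval p x ≈ 0#) → ∀ x → eval p x ≈ 0#
  ≈0-off-a-point p y zeros = infinitely-many-roots⇒≈0 p (λ i → y + ν (suc i))
    (λ i≢j eq → i≢j (ℕ.suc-injective (ν-injective (+-cancelˡ y _ _ eq))))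
    (λ i → zeros _ λ eq → ν-≉0 {suc i} (λ ()) (+-cancelˡ y _ _ (trans eq (sym (+-identityʳ y)))))
    where open import Algebra.Properties.Ring ring using () renaming (+-cancelˡ to +-cancelˡ)

  -- Shifting by a root of a quartic, and norms

  -- The coordinates A, B, C, D of an element A + B r + C t + D r t, where
  -- r² = w and t² = u + r.
  record Quartic : Set where
    constructor ⟪_,_,_,_⟫
    field A B C D : ℚ[X]

  infixl 6 _-ₚ_
  _-ₚ_ : ℚ[X] → ℚ[X] → ℚ[X]
  p -ₚ q = p +ₚ negₚ q

  infixl 7 _·ₚ_
  _·ₚ_ : ℕ → ℚ[X] → ℚ[X]
  n ·ₚ p = scale (fromℤ (+ n)) p

  ev-sub : ∀ p q x → (p -ₚ q) ⟨ x ⟩ ≈ p ⟨ x ⟩ - q ⟨ x ⟩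
  ev-sub p q x = trans (ev-+ p (negₚ q) x) (+-congˡ (ev-neg q x))

  ev-+-cong : ∀ {p q x y} z → p ⟨ z ⟩ ≈ x → q ⟨ z ⟩ ≈ y → (p +ₚ q) ⟨ z ⟩ ≈ x + y
  ev-+-cong {p} {q} z a b = trans (ev-+ p q z) (+-cong a b)

  ev-sub-cong : ∀ {p q x y} z → p ⟨ z ⟩ ≈ x → q ⟨ z ⟩ ≈ y → (p -ₚ q) ⟨ z ⟩ ≈ x - y
  ev-sub-cong {p} {q} z a b = trans (ev-sub p q z) (+-cong a (-‿cong b))

  module _ (u w : ℕ) where

    -- g(X − t), by Horner's rule.
    substitute : ℚ[X] → Quartic
    substitute []      = ⟪ [] , [] , [] , [] ⟫
    substitute (a ∷ g) = let ⟪ A , B , C , D ⟫ = substitute g in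
      ⟪ (a ∷ A) -ₚ (u ·ₚ C +ₚ w ·ₚ D)
      , shiftₚ B -ₚ (C +ₚ u ·ₚ D)
      , shiftₚ C -ₚ A
      , shiftₚ D -ₚ B ⟫

    -- The coordinates with respect to 1, r of (A + B r)² - (C + D r)² (u + r), the norm along t ↦
    -- -t.
    norm-rational norm-irrational : Quartic → ℚ[X]
    norm-rational   ⟪ A , B , C , D ⟫ =
      (A *ₚ A +ₚ w ·ₚ (B *ₚ B)) -ₚ (u ·ₚ (C *ₚ C +ₚ w ·ₚ (D *ₚ D)) +ₚ w ·ₚ (C *ₚ D +ₚ C *ₚ D))
    norm-irrational ⟪ A , B , C , D ⟫ =
      (A *ₚ B +ₚ A *ₚ B) -ₚ (u ·ₚ (C *ₚ D +ₚ C *ₚ D) +ₚ (C *ₚ C +ₚ w ·ₚ (D *ₚ D)))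

    -- The norm of g(X - t) down to rational coefficients: M + N r is the norm along t ↦ -t, and M²
    -- - w N² its norm along r ↦ -r. Its roots are the sums of a root of g and a root of the
    -- quartic.
    step : ℚ[X] → ℚ[X]
    step g = M *ₚ M -ₚ w ·ₚ (N *ₚ N)
      where
      M = norm-rational (substitute g)
      N = norm-irrational (substitute g)

    _⟦_⟧[_,_] : Quartic → Carrier → Carrier → Carrier → Carrier
    ⟪ A , B , C , D ⟫ ⟦ x ⟧[ r , t ] = (A ⟨ x ⟩ + B ⟨ x ⟩ * r) + (C ⟨ x ⟩ + D ⟨ x ⟩ * r) * t

    module _ {r t} (r²≈w : r * r ≈ ν w) (t²≈u+r : t * t ≈ ν u + r) where

      private
        -- The ring solver takes no hypotheses, so u and w are eliminated: the identities below are
        -- stated with t² - r and r² in their places.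
        u≈ : ν u ≈ t * t - r
        u≈ = sym (trans (+-congʳ t²≈u+r) (solve 2 (λ u r → u :+ r :- r := u) refl (ν u) r))

        ev-u : ∀ {p x y} → p ⟨ x ⟩ ≈ y → (u ·ₚ p) ⟨ x ⟩ ≈ (t * t - r) * y
        ev-u {p} {x} eq = trans (ev-scale (fromℤ (+ u)) p x) (*-cong u≈ eq)

        ev-w : ∀ {p x y} → p ⟨ x ⟩ ≈ y → (w ·ₚ p) ⟨ x ⟩ ≈ r * r * y
        ev-w {p} {x} eq = trans (ev-scale (fromℤ (+ w)) p x) (*-cong (sym r²≈w) eq)

      -- By t² = u + r and r² = w, multiplication by t sends (A, B, C, D) to (u C + w D, C + u D, A,
      -- B); the Horner step subtracts this from X (A, B, C, D) and adds the constant coefficient.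
      ev-substitute : ∀ g x → g ⟨ x - t ⟩ ≈ substitute g ⟦ x ⟧[ r , t ]
      ev-substitute []      x = sym (trans (+-cong 0+0* (trans (*-congʳ 0+0*) (zeroˡ t))) (+-identityˡ 0#))
        where
        0+0* : 0# + 0# * r ≈ 0#
        0+0* = trans (+-identityˡ _) (zeroˡ r)
      ev-substitute (a ∷ g) x = begin
        ι a + (x - t) * g ⟨ x - t ⟩                      ≈⟨ +-congˡ (*-congˡ (ev-substitute g x)) ⟩
        ι a + (x - t) * ((A′ + B′ * r) + (C′ + D′ * r) * t)
          ≈⟨ solve 8 (λ a x r t A B C D →
               a :+ (x :- t) :* ((A :+ B :* r) :+ (C :+ D :* r) :* t)
               := ((a :+ x :* A) :- ((t :* t :- r) :* C :+ (r :* r) :* D) :+ (x :* B :- (C :+ (t :* t :- r) :* D)) :* r)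
                  :+ ((x :* C :- A) :+ (x :* D :- B) :* r) :* t) refl (ι a) x r t A′ B′ C′ D′ ⟩
        ((ι a + x * A′) - ((t * t - r) * C′ + (r * r) * D′) + (x * B′ - (C′ + (t * t - r) * D′)) * r)
          + ((x * C′ - A′) + (x * D′ - B′) * r) * t
          ≈⟨ +-cong (+-cong (ev-sub-cong {a ∷ A} {u ·ₚ C +ₚ w ·ₚ D} x refl (ev-+-cong {u ·ₚ C} {w ·ₚ D} x (ev-u {C} refl) (ev-w {D} refl)))
                            (*-congʳ (ev-sub-cong {shiftₚ B} {C +ₚ u ·ₚ D} x (ev-shift B x) (ev-+-cong {C} {u ·ₚ D} x refl (ev-u {D} refl)))))
                    (*-congʳ (+-cong (ev-sub-cong {shiftₚ C} {A} x (ev-shift C x) refl)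
                                     (*-congʳ (ev-sub-cong {shiftₚ D} {B} x (ev-shift D x) refl)))) ⟨
        substitute (a ∷ g) ⟦ x ⟧[ r , t ]                ∎
        where
        open Quartic (substitute g)
        A′ = A ⟨ x ⟩
        B′ = B ⟨ x ⟩
        C′ = C ⟨ x ⟩
        D′ = D ⟨ x ⟩

      ev-norm : ∀ q x → q ⟦ x ⟧[ r , t ] * q ⟦ x ⟧[ r , - t ] ≈ norm-rational q ⟨ x ⟩ + norm-irrational q ⟨ x ⟩ * r
      ev-norm q@(⟪ A , B , C , D ⟫) x = begin
        q ⟦ x ⟧[ r , t ] * q ⟦ x ⟧[ r , - t ]
          ≈⟨ solve 6 (λ r t A B C D →
               ((A :+ B :* r) :+ (C :+ D :* r) :* t) :* ((A :+ B :* r) :+ (C :+ D :* r) :* :- t)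
               := ((A :* A :+ r :* r :* (B :* B)) :- ((t :* t :- r) :* (C :* C :+ r :* r :* (D :* D)) :+ r :* r :* (C :* D :+ C :* D)))
                  :+ ((A :* B :+ A :* B) :- ((t :* t :- r) :* (C :* D :+ C :* D) :+ (C :* C :+ r :* r :* (D :* D)))) :* r)
               refl r t (A ⟨ x ⟩) (B ⟨ x ⟩) (C ⟨ x ⟩) (D ⟨ x ⟩) ⟩
        _ ≈⟨ +-cong
               (ev-sub-cong {A *ₚ A +ₚ w ·ₚ (B *ₚ B)} {u ·ₚ (C *ₚ C +ₚ w ·ₚ (D *ₚ D)) +ₚ w ·ₚ (C *ₚ D +ₚ C *ₚ D)} x
                 (ev-+-cong {A *ₚ A} {w ·ₚ (B *ₚ B)} x (ev-* A A x) (ev-w {B *ₚ B} (ev-* B B x)))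
                 (ev-+-cong {u ·ₚ (C *ₚ C +ₚ w ·ₚ (D *ₚ D))} {w ·ₚ (C *ₚ D +ₚ C *ₚ D)} x
                   (ev-u {C *ₚ C +ₚ w ·ₚ (D *ₚ D)} C²+wD²) (ev-w {C *ₚ D +ₚ C *ₚ D} 2CD)))
               (*-congʳ (ev-sub-cong {A *ₚ B +ₚ A *ₚ B} {u ·ₚ (C *ₚ D +ₚ C *ₚ D) +ₚ (C *ₚ C +ₚ w ·ₚ (D *ₚ D))} x
                 (ev-+-cong {A *ₚ B} {A *ₚ B} x (ev-* A B x) (ev-* A B x))
                 (ev-+-cong {u ·ₚ (C *ₚ D +ₚ C *ₚ D)} {C *ₚ C +ₚ w ·ₚ (D *ₚ D)} x (ev-u {C *ₚ D +ₚ C *ₚ D} 2CD) C²+wD²))) ⟨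
        norm-rational q ⟨ x ⟩ + norm-irrational q ⟨ x ⟩ * r ∎
        where
        C²+wD² = ev-+-cong {C *ₚ C} {w ·ₚ (D *ₚ D)} x (ev-* C C x) (ev-w {D *ₚ D} (ev-* D D x))
        2CD    = ev-+-cong {C *ₚ D} {C *ₚ D} x (ev-* C D x) (ev-* C D x)

    ev-step : ∀ {r t t̄} → r * r ≈ ν w → t * t ≈ ν u + r → t̄ * t̄ ≈ ν u - r → ∀ g x →
              step g ⟨ x ⟩ ≈ (g ⟨ x - t ⟩ * g ⟨ x - - t ⟩) * (g ⟨ x - t̄ ⟩ * g ⟨ x - - t̄ ⟩)
    ev-step {r} {t} {t̄} r²≈w t²≈u+r t̄²≈u-r g x = begin
      step g ⟨ x ⟩
        ≈⟨ ev-sub-cong {M *ₚ M} {w ·ₚ (N *ₚ N)} x (ev-* M M x) (trans (ev-scale (fromℤ (+ w)) (N *ₚ N) x) (*-cong (sym r²≈w) (ev-* N N x))) ⟩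
      M ⟨ x ⟩ * M ⟨ x ⟩ - r * r * (N ⟨ x ⟩ * N ⟨ x ⟩)
        ≈⟨ solve 3 (λ m n r → m :* m :- r :* r :* (n :* n) := (m :+ n :* r) :* (m :+ n :* :- r)) refl (M ⟨ x ⟩) (N ⟨ x ⟩) r ⟩
      (M ⟨ x ⟩ + N ⟨ x ⟩ * r) * (M ⟨ x ⟩ + N ⟨ x ⟩ * - r)
        ≈⟨ *-cong (half r²≈w t²≈u+r) (half (trans (neg-square r) r²≈w) t̄²≈u-r) ⟨
      (g ⟨ x - t ⟩ * g ⟨ x - - t ⟩) * (g ⟨ x - t̄ ⟩ * g ⟨ x - - t̄ ⟩) ∎
      where
      M = norm-rational (substitute g)
      N = norm-irrational (substitute g)

      neg-square : ∀ x → - x * - x ≈ x * x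
      neg-square = solve 1 (λ x → :- x :* :- x := x :* x) refl

      -- M and N do not depend on the choice of r and t, so one computation serves both (r, t) and
      -- (-r, t̄).
      half : ∀ {r t} → r * r ≈ ν w → t * t ≈ ν u + r →
             g ⟨ x - t ⟩ * g ⟨ x - - t ⟩ ≈ M ⟨ x ⟩ + N ⟨ x ⟩ * r
      half {r} {t} r²≈w t²≈u+r = trans
        (*-cong (ev-substitute r²≈w t²≈u+r g x) (ev-substitute r²≈w (trans (neg-square t) t²≈u+r) g x))
        (ev-norm r²≈w t²≈u+r (substitute g) x)

  -- Subfields and quadratic extensions

  Subset : Set _
  Subset = Pred Carrier (c ⊔ ℓ₁)

  record IsSubfield (F : Subset) : Set (c ⊔ ℓ₁) where
    field
      ∈-resp : ∀ {x y} → x ≈ y → F x → F y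
      ∈-rat  : ∀ q → F (ι q)
      ∈-add  : ∀ {x y} → F x → F y → F (x + y)
      ∈-neg  : ∀ {x} → F x → F (- x)
      ∈-mul  : ∀ {x y} → F x → F y → F (x * y)
      ∈-inv  : ∀ {x y} → F x → x * y ≈ 1# → F y

    ∈-sub : ∀ {x y} → F x → F y → F (x - y)
    ∈-sub Fx Fy = ∈-add Fx (∈-neg Fy)

    ∈-0 : F 0#
    ∈-0 = ∈-resp 0#-homo (∈-rat 0ℚ)

    ∈-div : ∀ {x y z} → F x → F y → ¬ x ≈ 0# → x * z ≈ y → F z
    ∈-div {x} {y} {z} Fx Fy x≉0 xz≈y with inverse x≉0
    ... | x⁻¹ , xx⁻¹≈1 = ∈-resp (begin
      x⁻¹ * y          ≈⟨ *-congˡ xz≈y ⟨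
      x⁻¹ * (x * z)    ≈⟨ solve 3 (λ x y z → y :* (x :* z) := (x :* y) :* z) refl x x⁻¹ z ⟩
      (x * x⁻¹) * z    ≈⟨ *-congʳ xx⁻¹≈1 ⟩
      1# * z           ≈⟨ *-identityˡ z ⟩
      z                ∎) (∈-mul (∈-inv Fx xx⁻¹≈1) Fy)

    ∈-ev : ∀ p {x} → F x → F (p ⟨ x ⟩)
    ∈-ev []      Fx = ∈-0
    ∈-ev (a ∷ p) Fx = ∈-add (∈-rat a) (∈-mul Fx (∈-ev p Fx))

  Ext : Subset → Carrier → Subset
  Ext F r x = ∃ λ a → ∃ λ b → F a × F b × x ≈ a + b * r

  module Quadratic {F : Subset} (isSubfield : IsSubfield F) {r} (Fr² : F (r * r)) where
    open IsSubfield isSubfield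

    base : F ⊆ Ext F r
    base {x} Fx = x , 0# , Fx , ∈-0 , sym (trans (+-congˡ (zeroˡ r)) (+-identityʳ x))

    root∈ : Ext F r r
    root∈ = 0# , 1# , ∈-0 , ∈-resp 1#-homo (∈-rat 1ℚ) , sym (trans (+-identityˡ _) (*-identityˡ r))

    independent : ¬ F r → ∀ {a b} → F a → F b → a + b * r ≈ 0# → a ≈ 0# × b ≈ 0#
    independent r∉F {a} {b} Fa Fb eq with b ≈? 0#
    ... | yes b≈0 = trans (sym (trans (+-congˡ (trans (*-congʳ b≈0) (zeroˡ r))) (+-identityʳ a))) eq , b≈0
    ... | no  b≉0 = contradiction (∈-div Fb (∈-neg Fa) b≉0 (begin
      b * r              ≈⟨ solve 2 (λ a x → x := (a :+ x) :- a) refl a (b * r) ⟩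
      (a + b * r) - a    ≈⟨ +-congʳ eq ⟩
      0# - a             ≈⟨ +-identityˡ _ ⟩
      - a                ∎)) r∉F

    Ext-isSubfield : IsSubfield (Ext F r)
    Ext-isSubfield = record
      { ∈-resp = λ { x≈y (a , b , Fa , Fb , eq) → a , b , Fa , Fb , trans (sym x≈y) eq }
      ; ∈-rat  = λ q → base (∈-rat q)
      ; ∈-add  = λ { (a , b , Fa , Fb , eq) (a′ , b′ , Fa′ , Fb′ , eq′) → a + a′ , b + b′ , ∈-add Fa Fa′ , ∈-add Fb Fb′ ,
                 trans (+-cong eq eq′) (solve 5 (λ a b a′ b′ r → (a :+ b :* r) :+ (a′ :+ b′ :* r) := (a :+ a′) :+ (b :+ b′) :* r) refl a b a′ b′ r) }
      ; ∈-neg  = λ { (a , b , Fa , Fb , eq) → - a , - b , ∈-neg Fa , ∈-neg Fb ,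
                 trans (-‿cong eq) (solve 3 (λ a b r → :- (a :+ b :* r) := :- a :+ :- b :* r) refl a b r) }
      ; ∈-mul  = λ { (a , b , Fa , Fb , eq) (a′ , b′ , Fa′ , Fb′ , eq′) →
                 a * a′ + b * b′ * (r * r) , a * b′ + b * a′ ,
                 ∈-add (∈-mul Fa Fa′) (∈-mul (∈-mul Fb Fb′) Fr²) , ∈-add (∈-mul Fa Fb′) (∈-mul Fb Fa′) ,
                 trans (*-cong eq eq′) (solve 5 (λ a b a′ b′ r → (a :+ b :* r) :* (a′ :+ b′ :* r) := (a :* a′ :+ b :* b′ :* (r :* r)) :+ (a :* b′ :+ b :* a′) :* r) refl a b a′ b′ r) }
      ; ∈-inv  = inv′
      }
      where
      inv′ : ∀ {x y} → Ext F r x → x * y ≈ 1# → Ext F r y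
      -- The inverse is the conjugate a - b r over the norm. The conjugate of an invertible x can
      -- vanish if r happens to lie in F; then r = a / b, and x and its inverse lie in F.
      inv′ {x} {y} (a , b , Fa , Fb , x≈) xy≈1 with (a - b * r) ≈? 0#
      ... | no x̄≉0 = a * n⁻¹ , (- b) * n⁻¹ , ∈-mul Fa Fn⁻¹ , ∈-mul (∈-neg Fb) Fn⁻¹ , (begin
          y                              ≈⟨ *-identityˡ y ⟨
          1# * y                         ≈⟨ *-congʳ nn⁻¹≈1 ⟨
          (n * n⁻¹) * y                  ≈⟨ solve 3 (λ n m y → (n :* m) :* y := (n :* y) :* m) refl n n⁻¹ y ⟩
          (n * y) * n⁻¹                  ≈⟨ *-congʳ n*y≈x̄ ⟩
          (a - b * r) * n⁻¹              ≈⟨ solve 4 (λ a b r m → (a :- b :* r) :* m := a :* m :+ :- b :* m :* r) refl a b r n⁻¹ ⟩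
          a * n⁻¹ + (- b) * n⁻¹ * r      ∎)
        where
        n = a * a - b * b * (r * r)
        n*y≈x̄ : n * y ≈ a - b * r
        n*y≈x̄ = begin
          n * y                              ≈⟨ solve 4 (λ a b r y → (a :* a :- b :* b :* (r :* r)) :* y := ((a :+ b :* r) :* y) :* (a :- b :* r)) refl a b r y ⟩
          ((a + b * r) * y) * (a - b * r)    ≈⟨ *-congʳ (trans (*-congʳ (sym x≈)) xy≈1) ⟩
          1# * (a - b * r)                   ≈⟨ *-identityˡ _ ⟩
          a - b * r                          ∎
        n-inverse = inverse {n} (λ n≈0 → x̄≉0 (trans (sym n*y≈x̄) (trans (*-congʳ n≈0) (zeroˡ y))))
        n⁻¹ = proj₁ n-inverse
        nn⁻¹≈1 = proj₂ n-inverse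
        Fn⁻¹ : F n⁻¹
        Fn⁻¹ = ∈-inv (∈-sub (∈-mul Fa Fa) (∈-mul (∈-mul Fb Fb) Fr²)) nn⁻¹≈1
      ... | yes x̄≈0 with b ≈? 0#
      ...   | yes b≈0 = contradiction (begin
        1#                      ≈⟨ xy≈1 ⟨
        x * y                   ≈⟨ *-congʳ (trans x≈ (solve 3 (λ a b r → a :+ b :* r := (a :- b :* r) :+ b :* (r :+ r)) refl a b r)) ⟩
        ((a - b * r) + b * (r + r)) * y   ≈⟨ *-congʳ (+-cong x̄≈0 (trans (*-congʳ b≈0) (zeroˡ _))) ⟩
        (0# + 0#) * y           ≈⟨ trans (*-congʳ (+-identityˡ 0#)) (zeroˡ y) ⟩
        0#                      ∎) 1≉0
      ...   | no b≉0 = base (∈-inv (∈-resp (sym x≈) (∈-add Fa (∈-mul Fb (∈-div Fb Fa b≉0 (sym (x-y≈0⇒x≈y x̄≈0)))))) xy≈1)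

    -- If (a + b r)² ∈ F then 2 a b r ∈ F, so a = 0 or b = 0 or r ∈ F.
    square-root∈ : ∀ {t} → Ext F r t → F (t * t) → F t ⊎ F (t * r)
    square-root∈ {t} (a , b , Fa , Fb , t≈) Ft² with a ≈? 0# | b ≈? 0#
    ... | yes a≈0 | _ = inj₂ (∈-resp (begin
      b * (r * r)              ≈⟨ solve 2 (λ b r → b :* (r :* r) := (b :* r) :* r) refl b r ⟩
      (b * r) * r              ≈⟨ *-congʳ (trans (sym (+-identityˡ _)) (trans (+-congʳ (sym a≈0)) (sym t≈))) ⟩
      t * r                    ∎) (∈-mul Fb Fr²))
    ... | no _ | yes b≈0 = inj₁ (∈-resp (sym (trans t≈ (trans (+-congˡ (trans (*-congʳ b≈0) (zeroˡ r))) (+-identityʳ a)))) Fa)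
    ... | no a≉0 | no b≉0 = inj₁ (∈-resp (sym t≈) (∈-add Fa (∈-mul Fb Fr)))
      where
      Fr : F r
      Fr = ∈-div (∈-mul (∈-add Fa Fa) Fb) (∈-sub (∈-sub Ft² (∈-mul Fa Fa)) (∈-mul (∈-mul Fb Fb) Fr²))
        (*-≉0 (a≉0 ∘ x+x≈0⇒x≈0) b≉0)
        (begin
          (a + a) * b * r                                              ≈⟨ solve 3 (λ a b r → (a :+ a) :* b :* r := ((a :+ b :* r) :* (a :+ b :* r) :- a :* a) :- b :* b :* (r :* r)) refl a b r ⟩
          (a + b * r) * (a + b * r) - a * a - b * b * (r * r)          ≈⟨ +-congʳ (+-congʳ (*-cong t≈ t≈)) ⟨
          t * t - a * a - b * b * (r * r)                              ∎)

  Rational : Subset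
  Rational x = Lift c (∃ λ q → x ≈ ι q)

  Rational-isSubfield : IsSubfield Rational
  Rational-isSubfield = record
    { ∈-resp = λ { x≈y (lift (q , eq)) → lift (q , trans (sym x≈y) eq) }
    ; ∈-rat  = λ q → lift (q , refl)
    ; ∈-add  = λ { (lift (p , eq)) (lift (q , eq′)) → lift (p ℚ.+ q , trans (+-cong eq eq′) (sym (+-homo p q))) }
    ; ∈-neg  = λ { (lift (p , eq)) → lift (ℚ.- p , trans (-‿cong eq) (sym (-‿homo p))) }
    ; ∈-mul  = λ { (lift (p , eq)) (lift (q , eq′)) → lift (p ℚ.* q , trans (*-cong eq eq′) (sym (*-homo p q))) }
    ; ∈-inv  = λ { {x} {y} (lift (p , eq)) xy≈1 → inv′ p (trans (*-congʳ (sym eq)) xy≈1) }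
    }
    where
    open import Data.Rational.Properties as ℚ using (_≟_; *-inverseʳ)
    inv′ : ∀ p {y} → ι p * y ≈ 1# → Rational y
    inv′ p {y} py≈1 with p ≟ 0ℚ
    ... | yes ≡.refl = contradiction (trans (sym py≈1) (trans (*-congʳ 0#-homo) (zeroˡ y))) 1≉0
    ... | no p≢0 = lift (ℚ.1/ p , *-cancelˡ-≈ (λ p≈0 → p≢0 (ι-injective p≈0))
            (trans py≈1 (sym (trans (sym (*-homo p (ℚ.1/ p))) (trans (ι-cong (*-inverseʳ p)) 1#-homo)))))
      where instance _ = ℚ.≢-nonZero p≢0

  Adjoin-isSubfield : ∀ {S : Subset} → IsSubfield (Adjoin ℚ̄ S)
  Adjoin-isSubfield = record { ∈-resp = resp ; ∈-rat = rat ; ∈-add = add ; ∈-neg = neg ; ∈-mul = mul ; ∈-inv = inv }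

  SplittingField-isSubfield : ∀ {p} → IsSubfield (SplittingField ℚ̄ p)
  SplittingField-isSubfield = record { ∈-resp = resp ; ∈-rat = rat ; ∈-add = add ; ∈-neg = neg ; ∈-mul = mul ; ∈-inv = inv }

  Adjoin-least : ∀ {s} {S : Pred Carrier s} {F : Subset} → IsSubfield F → (∀ {x} → S x → F x) → ∀ {x} → Adjoin ℚ̄ S x → F x
  Adjoin-least {S = S} {F} isSubfield S⊆F = go
    where
    module F = IsSubfield isSubfield
    go : ∀ {x} → Adjoin ℚ̄ S x → F x
    go (gen Sx)      = S⊆F Sx
    go (rat q)       = F.∈-rat q
    go (add a b)     = F.∈-add (go a) (go b)
    go (neg a)       = F.∈-neg (go a)
    go (mul a b)     = F.∈-mul (go a) (go b)
    go (inv a eq)    = F.∈-inv (go a) eq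
    go (resp eq a)   = F.∈-resp eq (go a)

  -- The four roots of one quartic

  IsRoot : ℕ → Carrier → Set ℓ₁
  IsRoot j t = (t * t - ν (un j)) * (t * t - ν (un j)) ≈ ν (wn j)

  module _ (j : ℕ) where
    -- The square root of w that belongs to the root t, computed from t so that it need not be
    -- carried along.
    ρ : Carrier → Carrier
    ρ t = t * t - ν (un j)

    square≈u+ρ : ∀ t → t * t ≈ ν (un j) + ρ t
    square≈u+ρ t = solve 2 (λ t u → t :* t := u :+ (t :* t :- u)) refl t (ν (un j))

    abstract
      σ : Carrier
      σ = proj₁ (square-root (ν (dn j)))

      σ²≈d : σ * σ ≈ ν (dn j)
      σ²≈d = proj₂ (square-root (ν (dn j)))

    private
      ρ₀ = proj₁ (square-root (ν (wn j)))

    abstract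
      θ : Carrier
      θ = proj₁ (square-root (ν (un j) + ρ₀))

      θ-isRoot : IsRoot j θ
      θ-isRoot = trans (*-cong ρθ≈ρ₀ ρθ≈ρ₀) (proj₂ (square-root (ν (wn j))))
        where
        ρθ≈ρ₀ : ρ θ ≈ ρ₀
        ρθ≈ρ₀ = trans (+-congʳ (proj₂ (square-root (ν (un j) + ρ₀))))
          (solve 2 (λ u r → (u :+ r) :- u := r) refl (ν (un j)) ρ₀)

    u²≈w+d : ν (un j) * ν (un j) ≈ ν (wn j) + ν (dn j)
    u²≈w+d = trans (sym (ν-* (un j) (un j))) (trans (ι-cong (≡.cong (fromℤ ∘ +_) (u²≡w+d j))) (ν-+ (wn j) (dn j)))

    w≢0 : wn j ≢ 0
    w≢0 w≡0 = wm-nonsquare {j} {[]} {1} [] ∣-refl (0 , ≡.sym (≡.cong (ℕ._* 1) w≡0))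

    square-neg : ∀ x → - x * - x ≈ x * x
    square-neg = solve 1 (λ x → :- x :* :- x := x :* x) refl

    neg-isRoot : ∀ {t} → IsRoot j t → IsRoot j (- t)
    neg-isRoot {t} root = trans (*-cong (+-congʳ (square-neg t)) (+-congʳ (square-neg t))) root

    [u+r][u-r]≈d : ∀ {r} → r * r ≈ ν (wn j) → (ν (un j) + r) * (ν (un j) - r) ≈ ν (dn j)
    [u+r][u-r]≈d {r} r²≈w = begin
      (ν (un j) + r) * (ν (un j) - r)       ≈⟨ solve 2 (λ u r → (u :+ r) :* (u :- r) := u :* u :- r :* r) refl (ν (un j)) r ⟩
      ν (un j) * ν (un j) - r * r           ≈⟨ +-cong u²≈w+d (-‿cong r²≈w) ⟩
      (ν (wn j) + ν (dn j)) - ν (wn j)      ≈⟨ solve 2 (λ w d → (w :+ d) :- w := d) refl (ν (wn j)) (ν (dn j)) ⟩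
      ν (dn j)                              ∎

    module _ {t} (root : IsRoot j t) where
      root≉0 : ¬ t ≈ 0#
      root≉0 t≈0 = ν-≉0 (d≢0 j) (trans (sym ([u+r][u-r]≈d root)) (trans (*-congʳ
        (trans (sym (square≈u+ρ t)) (trans (*-congʳ t≈0) (zeroˡ t)))) (zeroˡ _)))

      ρ≉0 : ¬ ρ t ≈ 0#
      ρ≉0 ρ≈0 = ν-≉0 w≢0 (trans (sym root) (trans (*-congʳ ρ≈0) (zeroˡ _)))

      abstract
        -- Since (u + r) (u - r) = d = σ², the quotient σ / t is a square root of u - r. Defining it
        -- by division makes the product with t equal to σ itself and not only up to sign.
        bar : Carrier
        bar = proj₁ (inverse root≉0) * σ

        t*bar≈σ : t * bar ≈ σ
        t*bar≈σ = trans (sym (*-assoc t _ σ)) (trans (*-congʳ (proj₂ (inverse root≉0))) (*-identityˡ σ))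

      bar² : bar * bar ≈ ν (un j) - ρ t
      bar² = *-cancelˡ-≈ (*-≉0 root≉0 root≉0) (begin
        (t * t) * (bar * bar)                  ≈⟨ solve 2 (λ t b → (t :* t) :* (b :* b) := (t :* b) :* (t :* b)) refl t bar ⟩
        (t * bar) * (t * bar)                  ≈⟨ *-cong t*bar≈σ t*bar≈σ ⟩
        σ * σ                                  ≈⟨ σ²≈d ⟩
        ν (dn j)                               ≈⟨ [u+r][u-r]≈d root ⟨
        (ν (un j) + ρ t) * (ν (un j) - ρ t)    ≈⟨ *-congʳ (square≈u+ρ t) ⟨
        (t * t) * (ν (un j) - ρ t)             ∎)

      ρ-bar : ρ bar ≈ - ρ t
      ρ-bar = trans (+-congʳ bar²) (solve 2 (λ u r → (u :- r) :- u := :- r) refl (ν (un j)) (ρ t))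

      bar-isRoot : IsRoot j bar
      bar-isRoot = trans (*-cong ρ-bar ρ-bar) (trans (square-neg (ρ t)) root)

      data Conjugate (t′ : Carrier) : Set ℓ₁ where
        same     : t′ ≈ t → Conjugate t′
        minus    : t′ ≈ - t → Conjugate t′
        other    : t′ ≈ bar → Conjugate t′
        minus-other : t′ ≈ - bar → Conjugate t′

      conjugate : ∀ {t′} → IsRoot j t′ → Conjugate t′
      conjugate {t′} root′ = Sum.[ (λ ρ′≈ρ → Sum.[ same , minus ]′ (equal-squares (t′²≈ ρ′≈ρ (sym (square≈u+ρ t)))))
                                 , (λ ρ′≈-ρ → Sum.[ other , minus-other ]′ (equal-squares (t′²≈ ρ′≈-ρ (sym bar²)))) ]′
                                 (equal-squares (trans root′ (sym root)))
        where
        t′²≈ : ∀ {r y} → ρ t′ ≈ r → ν (un j) + r ≈ y → t′ * t′ ≈ y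
        t′²≈ ρ′≈r eq = trans (square≈u+ρ t′) (trans (+-congˡ ρ′≈r) eq)

      conjugate∈ : ∀ {F : Subset} → IsSubfield F → F t → F σ → ∀ {t′} → IsRoot j t′ → F t′
      conjugate∈ {F} isSubfield Ft Fσ root′ = go (conjugate root′)
        where
        open IsSubfield isSubfield
        Fbar : F bar
        Fbar = ∈-div Ft Fσ root≉0 t*bar≈σ
        go : ∀ {t′} → Conjugate t′ → F t′
        go (same eq)        = ∈-resp (sym eq) Ft
        go (minus eq)       = ∈-resp (sym eq) (∈-neg Ft)
        go (other eq)       = ∈-resp (sym eq) Fbar
        go (minus-other eq) = ∈-resp (sym eq) (∈-neg Fbar)

    -- Base fields over which a quartic keeps the group D₄

    -- The condition on w keeps r out of F, the one on d keeps t out of F(r) by taking norms, and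
    -- those on d and w d together keep σ out of F(r).
    record Fresh (F : Subset) : Set (c ⊔ ℓ₁) where
      field
        isSubfield : IsSubfield F
        √w∉        : ∀ {x} → F x → ¬ x * x ≈ ν (wn j)
        √d∉        : ∀ {x} → F x → ¬ x * x ≈ ν (dn j)
        √wd∉       : ∀ {x} → F x → ¬ x * x ≈ ν (wn j ℕ.* dn j)

      open IsSubfield isSubfield

      F-ν : ∀ n → F (ν n)
      F-ν n = ∈-rat (fromℤ (+ n))

      module _ {t} (root : IsRoot j t) where
        private
          r = ρ t

        Fr² : F (r * r)
        Fr² = ∈-resp (sym root) (F-ν (wn j))

        r∉F : ¬ F r
        r∉F Fr = √w∉ Fr root

        module F[r] = Quadratic isSubfield Fr²

        F[r]-isSubfield : IsSubfield (Ext F r)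
        F[r]-isSubfield = F[r].Ext-isSubfield

        u+r∈F[r] : Ext F r (t * t)
        u+r∈F[r] = IsSubfield.∈-resp F[r]-isSubfield (sym (square≈u+ρ t))
          (IsSubfield.∈-add F[r]-isSubfield (F[r].base (F-ν (un j))) F[r].root∈)

        module F[r,t] = Quadratic F[r]-isSubfield u+r∈F[r]

        σ²∈F[r] : Ext F r (σ * σ)
        σ²∈F[r] = F[r].base (∈-resp (sym σ²≈d) (F-ν (dn j)))

        module F[r,σ] = Quadratic F[r]-isSubfield σ²∈F[r]

        -- If n (u + r) is a square in F(r) then so is its norm n² d in F.
        √n[u+r]∉F[r] : ∀ {n x} → n ≢ 0 → Ext F r x → ¬ x * x ≈ ν n * (t * t)
        √n[u+r]∉F[r] {n} {x} n≢0 (a , b , Fa , Fb , x≈) x²≈ = √d∉ Fz z²≈d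
          where
          N = ν n
          U = ν (un j)
          rational-part = (a * a + b * b * (r * r)) - N * U
          irrational-part = (a * b + a * b) - N

          both≈0 : rational-part ≈ 0# × irrational-part ≈ 0#
          both≈0 = F[r].independent r∉F
            (∈-sub (∈-add (∈-mul Fa Fa) (∈-mul (∈-mul Fb Fb) Fr²)) (∈-mul (F-ν n) (F-ν (un j))))
            (∈-sub (∈-add (∈-mul Fa Fb) (∈-mul Fa Fb)) (F-ν n))
            (begin
              rational-part + irrational-part * r
                ≈⟨ solve 5 (λ a b r n u → ((a :* a :+ b :* b :* (r :* r)) :- n :* u) :+ ((a :* b :+ a :* b) :- n) :* r
                     := (a :+ b :* r) :* (a :+ b :* r) :- n :* (u :+ r)) refl a b r N U ⟩
              (a + b * r) * (a + b * r) - N * (U + r)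
                ≈⟨ x≈y⇒x-y≈0 (trans (sym (*-cong x≈ x≈)) (trans x²≈ (*-congˡ (square≈u+ρ t)))) ⟩
              0# ∎)

          N⁻¹ = proj₁ (inverse {N} (ν-≉0 n≢0))
          NN⁻¹≈1 : N * N⁻¹ ≈ 1#
          NN⁻¹≈1 = proj₂ (inverse {N} (ν-≉0 n≢0))

          z = (a * a - b * b * (r * r)) * N⁻¹

          Fz : F z
          Fz = ∈-mul (∈-sub (∈-mul Fa Fa) (∈-mul (∈-mul Fb Fb) Fr²)) (∈-inv (F-ν n) NN⁻¹≈1)

          z²≈d : z * z ≈ ν (dn j)
          z²≈d = begin
            z * z
              ≈⟨ solve 4 (λ a b r m → ((a :* a :- b :* b :* (r :* r)) :* m) :* ((a :* a :- b :* b :* (r :* r)) :* m)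
                   := ((a :* a :+ b :* b :* (r :* r)) :* (a :* a :+ b :* b :* (r :* r)) :- (a :* b :+ a :* b) :* (a :* b :+ a :* b) :* (r :* r)) :* (m :* m)) refl a b r N⁻¹ ⟩
            ((a * a + b * b * (r * r)) * (a * a + b * b * (r * r)) - (a * b + a * b) * (a * b + a * b) * (r * r)) * (N⁻¹ * N⁻¹)
              ≈⟨ *-congʳ (+-cong (*-cong p≈ p≈) (-‿cong (*-congʳ (*-cong q≈ q≈)))) ⟩
            ((N * U) * (N * U) - N * N * (r * r)) * (N⁻¹ * N⁻¹)
              ≈⟨ solve 4 (λ n u r m → ((n :* u) :* (n :* u) :- n :* n :* (r :* r)) :* (m :* m) := (n :* m) :* (n :* m) :* ((u :+ r) :* (u :- r))) refl N U r N⁻¹ ⟩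
            (N * N⁻¹) * (N * N⁻¹) * ((U + r) * (U - r))
              ≈⟨ *-cong (trans (*-cong NN⁻¹≈1 NN⁻¹≈1) (*-identityˡ 1#)) ([u+r][u-r]≈d root) ⟩
            1# * ν (dn j)
              ≈⟨ *-identityˡ _ ⟩
            ν (dn j) ∎
            where
            p≈ = x-y≈0⇒x≈y (proj₁ both≈0)
            q≈ = x-y≈0⇒x≈y (proj₂ both≈0)

        t∉F[r] : ¬ Ext F r t
        t∉F[r] t∈ = √n[u+r]∉F[r] {1} (λ ()) t∈ (trans (sym (*-identityˡ _)) (*-congʳ (sym 1#-homo)))

        xσ-square : ∀ {x y} → x * x ≈ y → (x * σ) * (x * σ) ≈ ν (dn j) * y
        xσ-square {x} {y} eq = begin
          (x * σ) * (x * σ)    ≈⟨ solve 2 (λ x s → (x :* s) :* (x :* s) := (s :* s) :* (x :* x)) refl x σ ⟩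
          (σ * σ) * (x * x)    ≈⟨ *-cong σ²≈d eq ⟩
          ν (dn j) * y         ∎

        -- Here the arbitrary factor n pays off: descent puts x or x σ into F(r), and the square of
        -- x σ has the same shape with d n instead of n.
        √n[u+r]∉F[r,σ] : ∀ {n x} → n ≢ 0 → Ext (Ext F r) σ x → ¬ x * x ≈ ν n * (t * t)
        √n[u+r]∉F[r,σ] {n} {x} n≢0 x∈ x²≈ = Sum.[ (λ x∈F[r] → √n[u+r]∉F[r] n≢0 x∈F[r] x²≈)
          , (λ xσ∈F[r] → √n[u+r]∉F[r] {dn j ℕ.* n} (Sum.[ (d≢0 j) , n≢0 ]′ ∘ ℕ.m*n≡0⇒m≡0∨n≡0 (dn j)) xσ∈F[r] xσ²) ]′
          (F[r,σ].square-root∈ x∈ (∈-resp′ (sym x²≈) (∈-mul′ (F[r].base (F-ν n)) u+r∈F[r])))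
          where
          open IsSubfield F[r]-isSubfield using () renaming (∈-resp to ∈-resp′; ∈-mul to ∈-mul′)
          xσ² : (x * σ) * (x * σ) ≈ ν (dn j ℕ.* n) * (t * t)
          xσ² = begin
            (x * σ) * (x * σ)          ≈⟨ xσ-square x²≈ ⟩
            ν (dn j) * (ν n * (t * t)) ≈⟨ *-assoc _ _ _ ⟨
            ν (dn j) * ν n * (t * t)   ≈⟨ *-congʳ (ν-* (dn j) n) ⟨
            ν (dn j ℕ.* n) * (t * t)   ∎

        σ∉F[r] : ¬ Ext F r σ
        σ∉F[r] σ∈ = Sum.[ (λ Fσ → √d∉ Fσ σ²≈d) , (λ Fσr → √wd∉ Fσr (begin
          (σ * r) * (σ * r)     ≈⟨ solve 2 (λ s r → (s :* r) :* (s :* r) := (r :* r) :* (s :* s)) refl σ r ⟩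
          (r * r) * (σ * σ)     ≈⟨ *-cong root σ²≈d ⟩
          ν (wn j) * ν (dn j)   ≈⟨ ν-* (wn j) (dn j) ⟨
          ν (wn j ℕ.* dn j)     ∎)) ]′ (F[r].square-root∈ σ∈ (∈-resp (sym σ²≈d) (F-ν (dn j))))

        -- This separates the fields of t and `bar`, whose product is σ. Descent leaves σ or σ t in
        -- F(r), and (σ t)² = d (u + r) is excluded by the norm argument.
        σ∉F[r,t] : ¬ Ext (Ext F r) t σ
        σ∉F[r,t] σ∈ = Sum.[ σ∉F[r] , (λ σt∈F[r] → √n[u+r]∉F[r] {dn j} (d≢0 j) σt∈F[r] (trans
          (solve 2 (λ s t → (s :* t) :* (s :* t) := (s :* s) :* (t :* t)) refl σ t) (*-congʳ σ²≈d))) ]′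
          (F[r,t].square-root∈ σ∈ σ²∈F[r])

      -- Independence of 1, r, t, r t over F.
      vanishing : ∀ {t t′} → IsRoot j t → IsRoot j t′ → ∀ g {x} → F x → g ⟨ x - t ⟩ ≈ 0# → g ⟨ x - t′ ⟩ ≈ 0#
      vanishing {t} {t′} root root′ g {x} Fx eq = begin
        g ⟨ x - t′ ⟩
          ≈⟨ ev-substitute (un j) (wn j) root′ (square≈u+ρ t′) g x ⟩
        (A ⟨ x ⟩ + B ⟨ x ⟩ * ρ t′) + (C ⟨ x ⟩ + D ⟨ x ⟩ * ρ t′) * t′
          ≈⟨ +-cong (+-cong (proj₁ AB≈0) (*-congʳ (proj₂ AB≈0))) (*-congʳ (+-cong (proj₁ CD≈0) (*-congʳ (proj₂ CD≈0)))) ⟩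
        (0# + 0# * ρ t′) + (0# + 0# * ρ t′) * t′
          ≈⟨ +-cong 0+0*≈0 (trans (*-congʳ 0+0*≈0) (zeroˡ t′)) ⟩
        0# + 0#
          ≈⟨ +-identityˡ 0# ⟩
        0# ∎
        where
        open Quartic (substitute (un j) (wn j) g)
        0+0*≈0 : ∀ {y} → 0# + 0# * y ≈ 0#
        0+0*≈0 = trans (+-identityˡ _) (zeroˡ _)
        outer : A ⟨ x ⟩ + B ⟨ x ⟩ * ρ t ≈ 0# × C ⟨ x ⟩ + D ⟨ x ⟩ * ρ t ≈ 0#
        outer = F[r,t].independent root (t∉F[r] root)
          (_ , _ , ∈-ev A Fx , ∈-ev B Fx , refl) (_ , _ , ∈-ev C Fx , ∈-ev D Fx , refl)
          (trans (sym (ev-substitute (un j) (wn j) root (square≈u+ρ t) g x)) eq)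
        AB≈0 = F[r].independent root (r∉F root) (∈-ev A Fx) (∈-ev B Fx) (proj₁ outer)
        CD≈0 = F[r].independent root (r∉F root) (∈-ev C Fx) (∈-ev D Fx) (proj₂ outer)

      -- Polarisation: in t² + t′² the r-parts cancel and leave 2 u, so 2 t t′ = 2 u - (t - t′)².
      product∈ : ∀ {t t′} → F (t - t′) → t′ * t′ ≈ ν (un j) - ρ t → F (t * t′)
      product∈ {t} {t′} Fδ t′²≈ = ∈-div (F-ν 2) (∈-sub (∈-add (F-ν (un j)) (F-ν (un j))) (∈-mul Fδ Fδ)) (ν-≉0 λ ()) (begin
        ν 2 * (t * t′)
          ≈⟨ solve 2 (λ t t′ → con (+ 2) :* (t :* t′) := (t :* t :+ t′ :* t′) :- (t :- t′) :* (t :- t′)) refl t t′ ⟩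
        (t * t + t′ * t′) - (t - t′) * (t - t′)
          ≈⟨ +-congʳ (+-cong (square≈u+ρ t) t′²≈) ⟩
        ((ν (un j) + ρ t) + (ν (un j) - ρ t)) - (t - t′) * (t - t′)
          ≈⟨ +-congʳ (solve 2 (λ u r → (u :+ r) :+ (u :- r) := u :+ u) refl (ν (un j)) (ρ t)) ⟩
        (ν (un j) + ν (un j)) - (t - t′) * (t - t′) ∎)

      -- The difference is 0, or 2 t, which is outside F, or t ∓ `bar`, from which polarisation
      -- would produce σ in F. Ultimately this is why the roots of `f` are simple.
      difference∈⇒≈ : ∀ {t t′} → IsRoot j t → IsRoot j t′ → F (t - t′) → t ≈ t′
      difference∈⇒≈ {t} {t′} root root′ Fδ = go (conjugate root root′)
        where
        go : Conjugate root t′ → t ≈ t′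
        go (same eq)  = sym eq
        go (minus eq) = contradiction (F[r].base root (∈-div (F-ν 2) Fδ (ν-≉0 λ ())
          (trans (solve 1 (λ t → con (+ 2) :* t := t :- :- t) refl t) (+-congˡ (-‿cong (sym eq)))))) (t∉F[r] root)
        go (other eq) = contradiction (F[r].base root (∈-resp (trans (*-congˡ eq) (t*bar≈σ root))
          (product∈ Fδ (trans (*-cong eq eq) (bar² root))))) (σ∉F[r] root)
        go (minus-other eq) = contradiction (F[r].base root (∈-resp -tt′≈σ (∈-neg (product∈ Fδ
          (trans (*-cong eq eq) (trans (square-neg (bar root)) (bar² root))))))) (σ∉F[r] root)
          where
          -tt′≈σ : - (t * t′) ≈ σ
          -tt′≈σ = trans (-‿cong (*-congˡ eq)) (trans (solve 2 (λ t b → :- (t :* :- b) := t :* b) refl t (bar root)) (t*bar≈σ root))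

  -- The tower of quadratic extensions

  -- θ comes last, over both r and σ, so that `√n[u+r]∉F[r,σ]` disposes of this layer in the
  -- descent. Each floor contains all four roots of its quartic.
  L : List ℕ → Subset
  L []       = Rational
  L (j ∷ js) = Ext (Ext (Ext (L js) (ρ j (θ j))) (σ j)) (θ j)

  module _ {F : Subset} (isSubfield : IsSubfield F) (j : ℕ) where
    open IsSubfield isSubfield

    ρ²∈ : F (ρ j (θ j) * ρ j (θ j))
    ρ²∈ = ∈-resp (sym (θ-isRoot j)) (∈-rat _)

    σ²∈ : F (σ j * σ j)
    σ²∈ = ∈-resp (sym (σ²≈d j)) (∈-rat _)

    module F[ρ] = Quadratic isSubfield ρ²∈
    module F[ρ,σ] = Quadratic F[ρ].Ext-isSubfield (F[ρ].base σ²∈)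

    θ²∈ : Ext (Ext F (ρ j (θ j))) (σ j) (θ j * θ j)
    θ²∈ = S.∈-resp (sym (square≈u+ρ j (θ j))) (S.∈-add (S.∈-rat _) (F[ρ,σ].base F[ρ].root∈))
      where module S = IsSubfield F[ρ,σ].Ext-isSubfield

    module F[ρ,σ,θ] = Quadratic F[ρ,σ].Ext-isSubfield θ²∈

  L-isSubfield : ∀ js → IsSubfield (L js)
  L-isSubfield []       = Rational-isSubfield
  L-isSubfield (j ∷ js) = F[ρ,σ,θ].Ext-isSubfield (L-isSubfield js) j

  L-tail : ∀ j js → L js ⊆ L (j ∷ js)
  L-tail j js = F[ρ,σ,θ].base (L-isSubfield js) j ∘ F[ρ,σ].base (L-isSubfield js) j ∘ F[ρ].base (L-isSubfield js) j

  σ∈L : ∀ {j js} → j ∈ₗ js → L js (σ j)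
  σ∈L {js = j ∷ js} (here ≡.refl) = F[ρ,σ,θ].base (L-isSubfield js) j (F[ρ,σ].root∈ (L-isSubfield js) j)
  σ∈L {js = i ∷ js} (there j∈)    = L-tail i js (σ∈L j∈)

  θ∈L : ∀ {j js} → j ∈ₗ js → L js (θ j)
  θ∈L {js = j ∷ js} (here ≡.refl) = F[ρ,σ,θ].root∈ (L-isSubfield js) j
  θ∈L {js = i ∷ js} (there j∈)    = L-tail i js (θ∈L j∈)

  root∈L : ∀ {j js t} → j ∈ₗ js → IsRoot j t → L js t
  root∈L {j} {js} j∈ root = conjugate∈ j (θ-isRoot j) (L-isSubfield js) (θ∈L j∈) (σ∈L j∈) root

  -- A deliberately coarse bound on the square classes that become trivial in the tower: all
  -- divisors of `Πw js` are allowed, because a new index only needs its parameters to be coprime to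
  -- that product.
  RationalSquares : List ℕ → Set _
  RationalSquares js = ∀ {x n} → L js x → x * x ≈ ν n → ∃ λ m → m ∣ Πw js × IsSquare (n ℕ.* m)

  fresh : ∀ {i js} → RationalSquares js → All (i ≢_) js → Fresh i (L js)
  fresh {i} {js} squares i∉js = record
    { isSubfield = L-isSubfield js
    ; √w∉  = λ Lx eq → let m , m∣ , sq = squares {n = wn i} Lx eq in wm-nonsquare {i} {js} {m} i∉js m∣ sq
    ; √d∉  = λ Lx eq → let m , m∣ , sq = squares {n = dn i} Lx eq in dm-nonsquare {i} {js} {m} i∉js m∣ sq
    ; √wd∉ = λ Lx eq → let m , m∣ , sq = squares {n = wn i ℕ.* dn i} Lx eq in wdm-nonsquare {i} {js} {m} i∉js m∣ sq
    }

  module _ {j js} (squares : RationalSquares js) (freshj : Fresh j (L js)) where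
    open Fresh freshj
    private
      r = ρ j (θ j)

    -- The four cases are √n, √n ρ, √n σ, √n ρ σ ∈ L js.
    descend : ∀ {x n} → L (j ∷ js) x → x * x ≈ ν n →
              ∃ λ g → g ∣ wn j × ∃ λ y → L js y × y * y ≈ ν (n ℕ.* g)
    -- The obstruction to √(n (u + r)) requires n nonzero; for n = 0 the element x is 0 and lies in
    -- every field.
    descend {x} {zero}  Lx x²≈n = 1 , 1∣ _ , x , IsSubfield.∈-resp (L-isSubfield js) (sym x≈0) (IsSubfield.∈-0 (L-isSubfield js)) , x²≈n
      where
      x≈0 : x ≈ 0#
      x≈0 = Sum.[ (λ z → z) , (λ z → z) ]′ (zero-product (trans x²≈n 0#-homo))
    descend {x} {n@(suc _)} Lx x²≈n = Sum.[ x∈ , (λ xθ∈ → contradiction xθ² (√n[u+r]∉F[r,σ] (θ-isRoot j) {n} (λ ()) xθ∈)) ]′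
      (F[ρ,σ,θ].square-root∈ (L-isSubfield js) j Lx
        (IsSubfield.∈-resp (F[ρ,σ].Ext-isSubfield (L-isSubfield js) j) (sym x²≈n) (IsSubfield.∈-rat (F[ρ,σ].Ext-isSubfield (L-isSubfield js) j) _)))
      where
      Goal = ∃ λ g → g ∣ wn j × ∃ λ y → L js y × y * y ≈ ν (n ℕ.* g)
      open IsSubfield (L-isSubfield js)

      xθ² : (x * θ j) * (x * θ j) ≈ ν n * (θ j * θ j)
      xθ² = trans (solve 2 (λ x t → (x :* t) :* (x :* t) := (x :* x) :* (t :* t)) refl x (θ j)) (*-congʳ x²≈n)

      times : ∀ {x y m n} → x * x ≈ ν m → y * y ≈ ν n → (x * y) * (x * y) ≈ ν (m ℕ.* n)
      times {x} {y} {m} {n} x² y² = trans (solve 2 (λ x y → (x :* y) :* (x :* y) := (x :* x) :* (y :* y)) refl x y)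
        (trans (*-cong x² y²) (sym (ν-* m n)))

      xσ² : (x * σ j) * (x * σ j) ≈ ν (n ℕ.* dn j)
      xσ² = times x²≈n (σ²≈d j)

      d⁻¹ : ∃ λ y → ν (dn j) * y ≈ 1#
      d⁻¹ = inverse (ν-≉0 (d≢0 j))

      -- The square of x σ r is n d w, and d w is no divisor of w. As w = d e, dividing by d leaves
      -- n e, with e a divisor of w.
      xσr/d² : let y = x * σ j * r * proj₁ d⁻¹ in y * y ≈ ν (n ℕ.* en j)
      xσr/d² = begin
        (x * σ j * r * proj₁ d⁻¹) * (x * σ j * r * proj₁ d⁻¹)
          ≈⟨ solve 2 (λ a b → (a :* b) :* (a :* b) := (a :* a) :* (b :* b)) refl (x * σ j * r) (proj₁ d⁻¹) ⟩
        ((x * σ j * r) * (x * σ j * r)) * (proj₁ d⁻¹ * proj₁ d⁻¹)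
          ≈⟨ *-congʳ (trans (times xσ² (θ-isRoot j)) (trans (ι-cong (≡.cong (fromℤ ∘ +_)
               (≡.trans (≡.cong (n ℕ.* dn j ℕ.*_) (w≡d*e j)) (ℕ-Solver.solve 3 (λ n d e → n ℕ-Solver.:* d ℕ-Solver.:* (d ℕ-Solver.:* e) ℕ-Solver.:= n ℕ-Solver.:* e ℕ-Solver.:* (d ℕ-Solver.:* d)) ≡.refl n (dn j) (en j)))))
               (trans (ν-* (n ℕ.* en j) (dn j ℕ.* dn j)) (*-congˡ (ν-* (dn j) (dn j)))))) ⟩
        ν (n ℕ.* en j) * (ν (dn j) * ν (dn j)) * (proj₁ d⁻¹ * proj₁ d⁻¹)
          ≈⟨ solve 3 (λ a d m → a :* (d :* d) :* (m :* m) := a :* ((d :* m) :* (d :* m))) refl (ν (n ℕ.* en j)) (ν (dn j)) (proj₁ d⁻¹) ⟩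
        ν (n ℕ.* en j) * ((ν (dn j) * proj₁ d⁻¹) * (ν (dn j) * proj₁ d⁻¹))
          ≈⟨ *-congˡ (trans (*-cong (proj₂ d⁻¹) (proj₂ d⁻¹)) (*-identityˡ 1#)) ⟩
        ν (n ℕ.* en j) * 1#
          ≈⟨ *-identityʳ _ ⟩
        ν (n ℕ.* en j) ∎

      square-root-L : ∀ {y m} → Ext (L js) r y → y * y ≈ ν m → L js y ⊎ L js (y * r)
      square-root-L y∈ y² = F[ρ].square-root∈ (L-isSubfield js) j y∈ (∈-resp (sym y²) (∈-rat _))

      x∈ : Ext (Ext (L js) r) (σ j) x → Goal
      x∈ x∈ = Sum.[ (λ x∈ → Sum.[ (λ Lx → 1 , 1∣ _ , x , Lx , trans x²≈n (ι-cong (≡.cong (fromℤ ∘ +_) (≡.sym (ℕ.*-identityʳ n)))))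
                                , (λ Lxr → wn j , ∣-refl , x * r , Lxr , times x²≈n (θ-isRoot j)) ]′ (square-root-L {m = n} x∈ x²≈n))
                  , (λ xσ∈ → Sum.[ (λ Lxσ → dn j , d∣w j , x * σ j , Lxσ , xσ²)
                                 , (λ Lxσr → en j , e∣w j , x * σ j * r * proj₁ d⁻¹ , ∈-mul Lxσr (∈-inv (∈-rat _) (proj₂ d⁻¹)) , xσr/d²) ]′
                                 (square-root-L {m = n ℕ.* dn j} xσ∈ xσ²)) ]′
        (F[ρ,σ].square-root∈ (L-isSubfield js) j x∈
          (IsSubfield.∈-resp (F[ρ].Ext-isSubfield (L-isSubfield js) j) (sym x²≈n) (IsSubfield.∈-rat (F[ρ].Ext-isSubfield (L-isSubfield js) j) _)))

  -- Control of squares in the tower below makes j fresh over it, and freshness allows the descent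
  -- by one floor, at the cost of a factor g of `wn j`. The accumulated factor stays a divisor of
  -- `Πw`.
  rational-squares : ∀ {js} → Unique js → RationalSquares js
  rational-squares [] {x} {n} (lift (q , x≈q)) x²≈n = 1 , ∣-refl , ≡.subst IsSquare (≡.sym (ℕ.*-identityʳ n))
    (rational-square⇒IsSquare q (ι-injective₂ (trans (*-homo q q) (trans (sym (*-cong x≈q x≈q)) x²≈n))))
  rational-squares {j ∷ js} (j∉js ∷ unique) {x} {n} Lx x²≈n =
    let squares : RationalSquares js
        squares = rational-squares unique
        g , g∣w , y , Ly , y²≈ = descend {j} {js} squares (fresh {j} {js} squares j∉js) {n = n} Lx x²≈n
        m , m∣Π , square       = squares {n = n ℕ.* g} Ly y²≈
    in m ℕ.* g , *-pres-∣ m∣Π g∣w , ≡.subst IsSquare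
         (ℕ-Solver.solve 3 (λ n g m → n ℕ-Solver.:* g ℕ-Solver.:* m ℕ-Solver.:= n ℕ-Solver.:* (m ℕ-Solver.:* g)) ≡.refl n g m) square

  fresh-L : ∀ {i js} → Unique js → All (i ≢_) js → Fresh i (L js)
  fresh-L unique = fresh (rational-squares unique)

  open Polynomials commutativeRing using () renaming (_+ₚ_ to _+̄_; _*ₚ_ to _*̄_)

  -- Polynomial functions and simple roots

  IsPolynomial : (Carrier → Carrier) → Set (c ⊔ ℓ₁)
  IsPolynomial h = ∃ λ p → ∀ z → h z ≈ eval p z

  polynomial-const : ∀ a → IsPolynomial (λ _ → a)
  polynomial-const a = a ∷ [] , λ z → sym (trans (+-congˡ (zeroʳ z)) (+-identityʳ a))

  eval-+̄ : ∀ p q z → eval (p +̄ q) z ≈ eval p z + eval q z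
  eval-+̄ []      q       z = sym (+-identityˡ _)
  eval-+̄ (a ∷ p) []      z = sym (+-identityʳ _)
  eval-+̄ (a ∷ p) (b ∷ q) z = trans (+-congˡ (*-congˡ (eval-+̄ p q z)))
    (solve 5 (λ a b z p q → a :+ b :+ z :* (p :+ q) := (a :+ z :* p) :+ (b :+ z :* q)) refl a b z (eval p z) (eval q z))

  eval-map-* : ∀ a q z → eval (map (a *_) q) z ≈ a * eval q z
  eval-map-* a []      z = sym (zeroʳ a)
  eval-map-* a (b ∷ q) z = trans (+-congˡ (*-congˡ (eval-map-* a q z)))
    (solve 4 (λ a b z q → a :* b :+ z :* (a :* q) := a :* (b :+ z :* q)) refl a b z (eval q z))

  eval-*̄ : ∀ p q z → eval (p *̄ q) z ≈ eval p z * eval q z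
  eval-*̄ []      q z = sym (zeroˡ _)
  eval-*̄ (a ∷ p) q z = begin
    eval (map (a *_) q +̄ (0# ∷ p *̄ q)) z                 ≈⟨ eval-+̄ (map (a *_) q) (0# ∷ p *̄ q) z ⟩
    eval (map (a *_) q) z + (0# + z * eval (p *̄ q) z)    ≈⟨ +-cong (eval-map-* a q z) (trans (+-identityˡ _) (*-congˡ (eval-*̄ p q z))) ⟩
    a * eval q z + z * (eval p z * eval q z)              ≈⟨ solve 4 (λ a z p q → a :* q :+ z :* (p :* q) := (a :+ z :* p) :* q) refl a z (eval p z) (eval q z) ⟩
    (a + z * eval p z) * eval q z                         ∎

  polynomial-+ : ∀ {g h} → IsPolynomial g → IsPolynomial h → IsPolynomial (λ z → g z + h z)
  polynomial-+ (p , g≈p) (q , h≈q) = p +̄ q , λ z → trans (+-cong (g≈p z) (h≈q z)) (sym (eval-+̄ p q z))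

  polynomial-* : ∀ {g h} → IsPolynomial g → IsPolynomial h → IsPolynomial (λ z → g z * h z)
  polynomial-* (p , g≈p) (q , h≈q) = p *̄ q , λ z → trans (*-cong (g≈p z) (h≈q z)) (sym (eval-*̄ p q z))

  polynomial-linear : ∀ a b → IsPolynomial (λ z → a * z + b)
  polynomial-linear a b = b ∷ a ∷ [] , λ z → begin
    a * z + b                    ≈⟨ solve 3 (λ a b z → a :* z :+ b := b :+ z :* a) refl a b z ⟩
    b + z * a                    ≈⟨ +-congˡ (*-congˡ (trans (+-congˡ (zeroʳ z)) (+-identityʳ a))) ⟨
    b + z * (a + z * 0#)         ∎

  polynomial-∘-linear : ∀ {g} → IsPolynomial g → ∀ a b → IsPolynomial (λ z → g (a * z + b))
  polynomial-∘-linear {g} (p , g≈p) a b = let q , eq = go p in q , λ z → trans (g≈p _) (eq z)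
    where
    go : ∀ p → IsPolynomial (λ z → eval p (a * z + b))
    go []      = polynomial-const 0#
    go (x ∷ p) = polynomial-+ (polynomial-const x) (polynomial-* (polynomial-linear a b) (go p))

  polynomial-ev : ∀ p → IsPolynomial (p ⟨_⟩)
  polynomial-ev p = map ι p , λ z → refl

  polynomial-resp : ∀ {g h} → (∀ z → g z ≈ h z) → IsPolynomial g → IsPolynomial h
  polynomial-resp g≈h (p , g≈p) = p , λ z → trans (sym (g≈h z)) (g≈p z)

  polynomial-shift : ∀ {g} → (∀ {x y} → x ≈ y → g x ≈ g y) → IsPolynomial g → ∀ b → IsPolynomial (λ z → g (z - b))
  polynomial-shift g-cong poly b = polynomial-resp (λ z → g-cong (+-congʳ (*-identityˡ z))) (polynomial-∘-linear poly 1# (- b))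

  record SimpleRoot (g : Carrier → Carrier) (a : Carrier) : Set (c ⊔ ℓ₁) where
    field
      quotient       : Poly
      factorisation  : ∀ z → g z ≈ (z - a) * eval quotient z
      quotient≉0     : ¬ eval quotient a ≈ 0#

    -- Off a the two cofactors agree by cancelling z - a, and polynomials that agree off one point
    -- agree at that point.
    quotient-unique : ∀ {h} → IsPolynomial h → (∀ z → g z ≈ (z - a) * h z) → ¬ h a ≈ 0#
    quotient-unique {h} poly@(q , h≈q) eq ha≈0 = quotient≉0 (begin
      eval quotient a                ≈⟨ solve 2 (λ q h → q := (q :+ :- h) :+ h) refl (eval quotient a) (h a) ⟩
      (eval quotient a + - h a) + h a    ≈⟨ +-cong (trans (proj₂ δ a) (≈0-off-a-point (proj₁ δ) a off a)) ha≈0 ⟩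
      0# + 0#                        ≈⟨ +-identityˡ 0# ⟩
      0#                             ∎)
      where
      δ : IsPolynomial (λ z → eval quotient z + - h z)
      δ = polynomial-+ (quotient , λ z → refl)
            (polynomial-resp (λ z → solve 1 (λ h → con (ℤ.- (+ 1)) :* h := :- h) refl (h z)) (polynomial-* (polynomial-const (ψ (ℤ.- (+ 1)))) poly))
      off : ∀ z → ¬ z ≈ a → eval (proj₁ δ) z ≈ 0#
      off z z≉a = trans (sym (proj₂ δ z)) (x≈y⇒x-y≈0
        (*-cancelˡ-≈ (z≉a ∘ x-y≈0⇒x≈y) (trans (sym (factorisation z)) (eq z))))

  irreducible-criterion : ∀ p {a} → SimpleRoot (p ⟨_⟩) a →
    (∀ g {b} → p ⟨ b ⟩ ≈ 0# → g ⟨ b ⟩ ≈ 0# → g ⟨ a ⟩ ≈ 0#) → Irreducible p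
  irreducible-criterion p {a} simple conjugate-roots = record { p∤1 = p∤1 ; split-∣1 = λ {x} {y} → split x y }
    where
    open SimpleRoot simple
    open import Algebra.Definitions.RawMagma using () renaming (_,_ to _∣,_)

    pa≈0 : p ⟨ a ⟩ ≈ 0#
    pa≈0 = trans (factorisation a) (trans (*-congʳ (-‿inverseʳ a)) (zeroˡ _))

    p∤1 : ¬ _
    p∤1 (q ∣, qp≈1) = 1≉0 (begin
      1#                      ≈⟨ trans (+-cong 1#-homo (zeroʳ a)) (+-identityʳ 1#) ⟨
      (1ℚ ∷ []) ⟨ a ⟩         ≈⟨ ev-≈ₚ (q *ₚ p) (1ℚ ∷ []) qp≈1 a ⟨
      (q *ₚ p) ⟨ a ⟩          ≈⟨ ev-* q p a ⟩
      q ⟨ a ⟩ * p ⟨ a ⟩       ≈⟨ trans (*-congˡ pa≈0) (zeroʳ _) ⟩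
      0#                      ∎)

    -- A non-constant cofactor shares a root with p, hence vanishes at a as
    -- well and makes it a double root.
    cofactor-unit : ∀ x y → (∀ z → p ⟨ z ⟩ ≈ x ⟨ z ⟩ * y ⟨ z ⟩) → x ⟨ a ⟩ ≈ 0# →
                    ∃ λ q → (q *ₚ y) ≈ₚ (1ℚ ∷ [])
    cofactor-unit x y p≈xy xa≈0 with degree? y
    ... | inj₁ y≈0 = contradiction refl (quotient-unique (polynomial-const 0#)
            (λ z → trans (p≈xy z) (trans (*-congˡ (ev-0 y y≈0 z)) (trans (zeroʳ _) (sym (zeroʳ _))))))
    ... | inj₂ (zero  , deg) = constant⇒unit y deg
    ... | inj₂ (suc d , deg) with nonconstant⇒root y deg
    ...   | b , yb≈0 = contradiction (trans (*-congʳ (-‿inverseʳ a)) (zeroˡ _))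
              (quotient-unique {λ z → (z - a) * (eval x′ z * eval y′ z)}
                (polynomial-* (polynomial-resp (λ z → +-congʳ (*-identityˡ z)) (polynomial-linear 1# (- a))) (polynomial-* (x′ , λ _ → refl) (y′ , λ _ → refl)))
                λ z → begin
                  p ⟨ z ⟩                                      ≈⟨ p≈xy z ⟩
                  x ⟨ z ⟩ * y ⟨ z ⟩                            ≈⟨ *-cong (proj₂ x-factor z) (proj₂ y-factor z) ⟩
                  ((z - a) * eval x′ z) * ((z - a) * eval y′ z)  ≈⟨ solve 3 (λ d x y → (d :* x) :* (d :* y) := d :* (d :* (x :* y))) refl (z - a) (eval x′ z) (eval y′ z) ⟩
                  (z - a) * ((z - a) * (eval x′ z * eval y′ z)) ∎)
      where
      x-factor = root-factor (map ι x) xa≈0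
      x′ = proj₁ x-factor
      y-factor = root-factor (map ι y) (conjugate-roots y (trans (p≈xy b) (trans (*-congˡ yb≈0) (zeroʳ _))) yb≈0)
      y′ = proj₁ y-factor

    split : ∀ x y → p ≈ₚ (x *ₚ y) → _ ⊎ _
    split x y p≈xy = Sum.[ (λ xa≈0 → let q , eq = cofactor-unit x y p⟨⟩ xa≈0 in inj₂ (q ∣, eq))
                         , (λ ya≈0 → let q , eq = cofactor-unit y x (λ z → trans (p⟨⟩ z) (*-comm _ _)) ya≈0 in inj₁ (q ∣, eq)) ]′
                         (zero-product (trans (sym (p⟨⟩ a)) pa≈0))
      where
      p⟨⟩ : ∀ z → p ⟨ z ⟩ ≈ x ⟨ z ⟩ * y ⟨ z ⟩
      p⟨⟩ z = trans (ev-≈ₚ p (x *ₚ y) p≈xy z) (ev-* x y z)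

  -- The polynomials whose roots are sums of one root of each quartic

  f : ℕ → ℚ[X]
  f zero    = 0ℚ ∷ 1ℚ ∷ []
  f (suc k) = step (un k) (wn k) (f k)

  data RootSum : ℕ → Carrier → Set (c ⊔ ℓ₁) where
    empty : ∀ {x} → x ≈ 0# → RootSum 0 x
    plus  : ∀ {k y t x} → RootSum k y → IsRoot k t → x ≈ y + t → RootSum (suc k) x

  fresh-downFrom : ∀ k → Fresh k (L (downFrom k))
  fresh-downFrom k = fresh-L (downFrom⁺ k) (All.tabulate λ i∈ k≡i → ℕ.<-irrefl (≡.sym k≡i) (∈-downFrom⁻ i∈))

  RootSum∈L : ∀ {k x} → RootSum k x → L (downFrom k) x
  RootSum∈L (empty x≈0) = lift (0ℚ , trans x≈0 (sym 0#-homo))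
  RootSum∈L {suc k} (plus y-sum root eq) = ∈-resp (sym eq) (∈-add (L-tail k (downFrom k) (RootSum∈L y-sum)) (root∈L {js = downFrom (suc k)} (here ≡.refl) root))
    where open IsSubfield (L-isSubfield (downFrom (suc k)))

  module _ (k : ℕ) where

    ev-step-root : ∀ {t} (root : IsRoot k t) g x → step (un k) (wn k) g ⟨ x ⟩ ≈
                   (g ⟨ x - t ⟩ * g ⟨ x - - t ⟩) * (g ⟨ x - bar k root ⟩ * g ⟨ x - - bar k root ⟩)
    ev-step-root {t} root = ev-step (un k) (wn k) root (square≈u+ρ k t) (bar² k root)

    step-root⇒ : ∀ g {x} → step (un k) (wn k) g ⟨ x ⟩ ≈ 0# → ∃ λ t → IsRoot k t × g ⟨ x - t ⟩ ≈ 0#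
    step-root⇒ g {x} eq = Sum.[ pair (θ-isRoot k) , pair (bar-isRoot k (θ-isRoot k)) ]′
      (zero-product (trans (sym (ev-step-root (θ-isRoot k) g x)) eq))
      where
      pair : ∀ {t} → IsRoot k t → g ⟨ x - t ⟩ * g ⟨ x - - t ⟩ ≈ 0# → ∃ λ t → IsRoot k t × g ⟨ x - t ⟩ ≈ 0#
      pair {t} root eq = Sum.[ (λ z → t , root , z) , (λ z → - t , neg-isRoot k root , z) ]′ (zero-product eq)

    step-root⇐ : ∀ g {x t} → IsRoot k t → g ⟨ x - t ⟩ ≈ 0# → step (un k) (wn k) g ⟨ x ⟩ ≈ 0#
    step-root⇐ g {x} {t} root eq = trans (ev-step-root root g x)
      (trans (*-congʳ (trans (*-congʳ eq) (zeroˡ _))) (zeroˡ _))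

  x+y-y≈x : ∀ x y → (x + y) - y ≈ x
  x+y-y≈x = solve 2 (λ x y → (x :+ y) :- y := x) refl

  x--y≈x+y : ∀ x y → x - - y ≈ x + y
  x--y≈x+y = solve 2 (λ x y → x :- :- y := x :+ y) refl

  f-root⇒ : ∀ k {x} → f k ⟨ x ⟩ ≈ 0# → RootSum k x
  f-root⇒ zero {x} eq = empty (trans (sym (begin
    ι 0ℚ + x * (ι 1ℚ + x * 0#)   ≈⟨ +-cong 0#-homo (*-congˡ (trans (+-cong 1#-homo (zeroʳ x)) (+-identityʳ 1#))) ⟩
    0# + x * 1#                  ≈⟨ trans (+-identityˡ _) (*-identityʳ x) ⟩
    x                            ∎)) eq)
  f-root⇒ (suc k) {x} eq = let t , root , eq′ = step-root⇒ k (f k) eq in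
    plus (f-root⇒ k eq′) root (solve 2 (λ x t → x := (x :- t) :+ t) refl x t)

  f-root⇐ : ∀ {k x} → RootSum k x → f k ⟨ x ⟩ ≈ 0#
  f-root⇐ {x = x} (empty x≈0) = begin
    ι 0ℚ + x * (ι 1ℚ + x * 0#)   ≈⟨ +-cong 0#-homo (*-congʳ x≈0) ⟩
    0# + 0# * _                  ≈⟨ trans (+-identityˡ _) (zeroˡ _) ⟩
    0#                           ∎
  f-root⇐ {suc k} {x} (plus {y = y} {t} y-sum root eq) = step-root⇐ k (f k) root
    (trans (ev-cong (f k) (trans (+-congʳ eq) (x+y-y≈x y t))) (f-root⇐ y-sum))

  -- Transitivity on the sums, one summand at a time. The norm `step` of g over the last summand
  -- vanishes at the sum of the others, so the induction, which is for all g, moves those; over the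
  -- field that contains them `vanishing` then exchanges the last summand. Signs enter because
  -- `step` is about x - t.
  conjugates-vanish : ∀ {k x y} → RootSum k x → RootSum k y → ∀ g → g ⟨ x ⟩ ≈ 0# → g ⟨ y ⟩ ≈ 0#
  conjugates-vanish (empty x≈0) (empty y≈0) g eq = trans (ev-cong g (trans y≈0 (sym x≈0))) eq
  conjugates-vanish {suc k} (plus {y = x} {t} x-sum root x+t) (plus {y = y} {s} y-sum root′ y+s) g eq =
    let t′ , root″ , eq″ = step-root⇒ k g (conjugates-vanish x-sum y-sum (step (un k) (wn k) g)
          (step-root⇐ k g (neg-isRoot k root) (trans (ev-cong g (trans (x--y≈x+y x t) (sym x+t))) eq)))
    in trans (ev-cong g (trans y+s (sym (x--y≈x+y y s))))
         (Fresh.vanishing (fresh-downFrom k) root″ (neg-isRoot k root′) g (RootSum∈L y-sum) eq″)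

  -- Both y and (y + t) - t′ are sums of roots of the earlier quartics, so t - t′ lies in their
  -- field, over which the k-th quartic is fresh.
  f-root-separated : ∀ {k y t t′} → RootSum k y → IsRoot k t → IsRoot k t′ → f k ⟨ (y + t) - t′ ⟩ ≈ 0# → t ≈ t′
  f-root-separated {k} {y} {t} {t′} y-sum root root′ eq = Fresh.difference∈⇒≈ (fresh-downFrom k) root root′
    (∈-resp (solve 3 (λ y t t′ → ((y :+ t) :- t′) :- y := t :- t′) refl y t t′)
      (∈-sub (RootSum∈L (f-root⇒ k eq)) (RootSum∈L y-sum)))
    where open IsSubfield (L-isSubfield (downFrom k))

  module _ {k t} (root : IsRoot k t) where
    t≉-t : ¬ t ≈ - t
    t≉-t eq = root≉0 k root (x+x≈0⇒x≈0 (trans (+-congˡ eq) (-‿inverseʳ t)))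

    squares-differ : ¬ t * t ≈ bar k root * bar k root
    squares-differ eq = ρ≉0 k root (x+x≈0⇒x≈0 (begin
      ρ k t + ρ k t                                ≈⟨ solve 2 (λ u r → r :+ r := (u :+ r) :- (u :- r)) refl (ν (un k)) (ρ k t) ⟩
      (ν (un k) + ρ k t) - (ν (un k) - ρ k t)      ≈⟨ x≈y⇒x-y≈0 (trans (sym (square≈u+ρ k t)) (trans eq (bar² k root))) ⟩
      0#                                           ∎))

    t≉bar : ¬ t ≈ bar k root
    t≉bar eq = squares-differ (*-cong eq eq)

    t≉-bar : ¬ t ≈ - bar k root
    t≉-bar eq = squares-differ (trans (*-cong eq eq) (square-neg k _))

  -- Of the four shifted copies of `f k`, only the one shifted by t vanishes at x, by
  -- `f-root-separated`, and it does so simply by induction.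
  f-simple : ∀ {k x} → RootSum k x → SimpleRoot (f k ⟨_⟩) x
  f-simple {x = x} (empty x≈0) = record
    { quotient = 1# ∷ []
    ; factorisation = λ z → begin
        ι 0ℚ + z * (ι 1ℚ + z * 0#)     ≈⟨ +-cong 0#-homo (*-congˡ (+-congʳ 1#-homo)) ⟩
        0# + z * (1# + z * 0#)         ≈⟨ +-identityˡ _ ⟩
        z * (1# + z * 0#)              ≈⟨ *-congʳ (trans (+-congˡ (trans (-‿cong x≈0) -0#≈0#)) (+-identityʳ z)) ⟨
        (z - x) * (1# + z * 0#)        ∎
    ; quotient≉0 = λ eq → 1≉0 (trans (sym (trans (+-congˡ (zeroʳ x)) (+-identityʳ 1#))) eq)
    }
  f-simple {suc k} {x} (plus {y = y} {t} y-sum root x≈y+t) = record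
    { quotient = proj₁ Q
    ; factorisation = λ z → begin
        f (suc k) ⟨ z ⟩
          ≈⟨ ev-step-root k root (f k) z ⟩
        (f k ⟨ z - t ⟩ * f k ⟨ z - - t ⟩) * (f k ⟨ z - t̄ ⟩ * f k ⟨ z - - t̄ ⟩)
          ≈⟨ *-congʳ (*-congʳ (factorisation (z - t))) ⟩
        ((((z - t) - y) * eval quotient (z - t)) * f k ⟨ z - - t ⟩) * (f k ⟨ z - t̄ ⟩ * f k ⟨ z - - t̄ ⟩)
          ≈⟨ solve 6 (λ z t y q a b → ((((z :- t) :- y) :* q) :* a) :* b := (z :- (y :+ t)) :* ((q :* a) :* b)) refl z t y (eval quotient (z - t)) (f k ⟨ z - - t ⟩) (f k ⟨ z - t̄ ⟩ * f k ⟨ z - - t̄ ⟩) ⟩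
        (z - (y + t)) * ((eval quotient (z - t) * f k ⟨ z - - t ⟩) * (f k ⟨ z - t̄ ⟩ * f k ⟨ z - - t̄ ⟩))
          ≈⟨ *-cong (+-congˡ (-‿cong (sym x≈y+t))) (proj₂ Q z) ⟩
        (z - x) * eval (proj₁ Q) z ∎
    ; quotient≉0 = *-≉0 (*-≉0 quotient≉0′ (other-factor (neg-isRoot k root) (t≉-t root)))
                        (*-≉0 (other-factor (bar-isRoot k root) (t≉bar root)) (other-factor (neg-isRoot k (bar-isRoot k root)) (t≉-bar root)))
                   ∘ trans (proj₂ Q x)
    }
    where
    open SimpleRoot (f-simple y-sum)
    t̄ = bar k root

    Q : IsPolynomial (λ z → (eval quotient (z - t) * f k ⟨ z - - t ⟩) * (f k ⟨ z - t̄ ⟩ * f k ⟨ z - - t̄ ⟩))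
    Q = polynomial-* (polynomial-* (polynomial-shift (eval-cong quotient) (quotient , λ _ → refl) t) (shifted (- t)))
                     (polynomial-* (shifted t̄) (shifted (- t̄)))
      where
      shifted : ∀ s → IsPolynomial (λ z → f k ⟨ z - s ⟩)
      shifted = polynomial-shift (ev-cong (f k)) (polynomial-ev (f k))

    quotient≉0′ : ¬ eval quotient (x - t) ≈ 0#
    quotient≉0′ = quotient≉0 ∘ trans (eval-cong quotient (sym (trans (+-congʳ x≈y+t) (x+y-y≈x y t))))

    other-factor : ∀ {t′} → IsRoot k t′ → ¬ t ≈ t′ → ¬ f k ⟨ x - t′ ⟩ ≈ 0#
    other-factor root′ t≉t′ eq = t≉t′ (f-root-separated y-sum root root′ (trans (ev-cong (f k) (+-congʳ (sym x≈y+t))) eq))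

  sum : (ℕ → Carrier) → ℕ → Carrier
  sum t zero    = 0#
  sum t (suc k) = sum t k + t k

  sum-RootSum : ∀ {t} → (∀ j → IsRoot j (t j)) → ∀ k → RootSum k (sum t k)
  sum-RootSum roots zero    = empty refl
  sum-RootSum roots (suc k) = plus (sum-RootSum roots k) (roots k) refl

  module _ {M : Subset} (isSubfield : IsSubfield M) where
    open IsSubfield isSubfield

    -- Over M, the norms M(x) ± N(x) r of g(x ∓ t) locate first r, then t.
    last-summand∈ : ∀ {k y t x} → RootSum k y → IsRoot k t → x ≈ y + t → M x → M t
    last-summand∈ {k} {y} {t} {x} y-sum root x≈y+t Mx = Mt
      where
      g = f k
      r = ρ k t
      q = substitute (un k) (wn k) g
      open Quartic q
      X = norm-rational (un k) (wn k) q ⟨ x ⟩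
      Y = norm-irrational (un k) (wn k) q ⟨ x ⟩

      MX : M X
      MX = ∈-ev (norm-rational (un k) (wn k) q) Mx
      MY : M Y
      MY = ∈-ev (norm-irrational (un k) (wn k) q) Mx

      gt≈0 : g ⟨ x - t ⟩ ≈ 0#
      gt≈0 = trans (ev-cong g (trans (+-congʳ x≈y+t) (x+y-y≈x y t))) (f-root⇐ y-sum)

      other-factor : ∀ {t′} → IsRoot k t′ → ¬ t ≈ t′ → ¬ g ⟨ x - t′ ⟩ ≈ 0#
      other-factor root′ t≉t′ eq = t≉t′ (f-root-separated y-sum root root′ (trans (ev-cong g (+-congʳ (sym x≈y+t))) eq))

      half : ∀ {s} → IsRoot k s → g ⟨ x - s ⟩ * g ⟨ x - - s ⟩ ≈ X + Y * ρ k s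
      half {s} root = trans
        (*-cong (ev-substitute (un k) (wn k) root (square≈u+ρ k s) g x)
                (ev-substitute (un k) (wn k) root (trans (square-neg k s) (square≈u+ρ k s)) g x))
        (ev-norm (un k) (wn k) root (square≈u+ρ k s) q x)

      X+Yr≈0 : X + Y * r ≈ 0#
      X+Yr≈0 = trans (sym (half root)) (trans (*-congʳ gt≈0) (zeroˡ _))

      -- This is the norm over the other pair ± `bar`, where no factor vanishes.
      X-Yr≉0 : ¬ X + Y * - r ≈ 0#
      X-Yr≉0 eq = *-≉0 (other-factor (bar-isRoot k root) (t≉bar root)) (other-factor (neg-isRoot k (bar-isRoot k root)) (t≉-bar root))
        (trans (half (bar-isRoot k root)) (trans (+-congˡ (*-congˡ (ρ-bar k root))) eq))

      -- The inequation forces b to be nonzero, so that s = -a / b.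
      solution∈ : ∀ {a b s} → M a → M b → a + b * s ≈ 0# → ¬ a + b * - s ≈ 0# → M s
      solution∈ {a} {b} {s} Ma Mb eq ne = ∈-div Mb (∈-neg Ma)
        (λ b≈0 → ne (trans (+-congˡ (trans (*-congʳ b≈0) (trans (zeroˡ _) (sym (trans (*-congʳ b≈0) (zeroˡ s)))))) eq))
        (trans (solve 2 (λ a x → x := (a :+ x) :- a) refl a (b * s)) (trans (+-congʳ eq) (+-identityˡ _)))

      Mr : M r
      Mr = solution∈ MX MY X+Yr≈0 X-Yr≉0

      Mt : M t
      Mt = solution∈ (∈-add (∈-ev A Mx) (∈-mul (∈-ev B Mx) Mr)) (∈-add (∈-ev C Mx) (∈-mul (∈-ev D Mx) Mr))
        (trans (sym (ev-substitute (un k) (wn k) root (square≈u+ρ k t) g x)) gt≈0)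
        (λ eq → other-factor (neg-isRoot k root) (t≉-t root)
          (trans (ev-substitute (un k) (wn k) root (trans (square-neg k t) (square≈u+ρ k t)) g x) eq))

    summands∈ : ∀ {t} → (∀ j → IsRoot j (t j)) → ∀ k → M (sum t k) → ∀ {j} → j ℕ.< k → M (t j)
    summands∈ {t} roots (suc k) Mx {j} (ℕ.s≤s j≤k) = Sum.[ (λ j<k → summands∈ roots k My j<k) , (λ { ≡.refl → Mt }) ]′ (ℕ.m≤n⇒m<n∨m≡n j≤k)
      where
      Mt : M (t k)
      Mt = last-summand∈ (sum-RootSum roots k) (roots k) refl Mx
      My : M (sum t k)
      My = ∈-resp (x+y-y≈x _ _) (∈-sub Mx Mt)

    RootSum∈ : ∀ {k x} → (∀ {j t} → j ℕ.< k → IsRoot j t → M t) → RootSum k x → M x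
    RootSum∈ Mroots (empty x≈0) = ∈-resp (sym x≈0) ∈-0
    RootSum∈ Mroots (plus y-sum root eq) = ∈-resp (sym eq) (∈-add (RootSum∈ (Mroots ∘ ℕ.m<n⇒m<1+n) y-sum) (Mroots (ℕ.n<1+n _) root))

  -- Minimal generating sets

  -- Membership in an arbitrary subset is undecidable, so no missing generator can be exhibited; as
  -- minimality is a negation, a finite double negation shift is enough.
  ¬¬-∀-Fin : ∀ {a m} {P : Fin m → Set a} → (∀ i → ¬ ¬ P i) → ¬ ¬ (∀ i → P i)
  ¬¬-∀-Fin {m = zero}  ¬¬P ¬∀P = ¬∀P λ ()
  ¬¬-∀-Fin {m = suc m} ¬¬P ¬∀P = ¬¬P zero λ P0 → ¬¬-∀-Fin (¬¬P ∘ suc) λ Psuc → ¬∀P λ { zero → P0 ; (suc i) → Psuc i }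

  module _ {p : ℚ[X]} {m : ℕ} (b : Fin m → Carrier) where

    Image : Subset
    Image x = Lift c (∃ λ i → x ≈ b i)

    ImageExcept : Fin m → Subset
    ImageExcept i x = Lift c (∃ λ l → l ≢ i × x ≈ b l)

    -- Omitting a single index is the only case to test, since a proper subset lies in such an
    -- `ImageExcept`. The same hypothesis makes b injective: of two equal generators one could be
    -- omitted without loss.
    minimal-generating-set : (∀ i → Roots ℚ̄ p (b i)) → Roots ℚ̄ p ⊆ Adjoin ℚ̄ Image →
      (∀ i → ¬ (Roots ℚ̄ p ⊆ Adjoin ℚ̄ (ImageExcept i))) → HasMinimalGeneratingSetOfSize ℚ̄ p m
    minimal-generating-set b-root generates essential = Image , record
      { respects  = λ { x≈y (lift (i , eq)) → lift (i , trans (sym x≈y) eq) }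
      ; roots     = image-root
      ; generates = Adjoin-least (SplittingField-isSubfield {p}) (gen ∘ image-root) , Adjoin-least Adjoin-isSubfield generates
      ; minimal   = λ A A-resp (A⊆B , B⊈A) (_ , split⊆A) →
          ¬¬-∀-Fin (λ i bi∉A → essential i λ root → Adjoin-least Adjoin-isSubfield (gen ∘ except A A-resp A⊆B i bi∉A) (split⊆A (gen root)))
                   (λ b∈A → B⊈A λ { (lift (i , eq)) → A-resp (sym eq) (b∈A i) })
      } , record
      { to        = λ i → b i , lift (i , refl)
      ; cong      = λ { ≡.refl → refl }
      ; bijective = injective , λ { (x , lift (i , eq)) → i , λ { ≡.refl → sym eq } }
      }
      where
      image-root : Image ⊆ Roots ℚ̄ p
      image-root (lift (i , eq)) = trans (ev-cong p eq) (b-root i)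

      except : ∀ (A : Subset) → (∀ {x y} → x ≈ y → A x → A y) → A ⊆ Image → ∀ i → ¬ A (b i) → A ⊆ ImageExcept i
      except A A-resp A⊆B i bi∉A Ax with A⊆B Ax
      ... | lift (l , eq) = lift (l , (λ { ≡.refl → bi∉A (A-resp eq Ax) }) , eq)

      injective : ∀ {i l} → b i ≈ b l → i ≡ l
      injective {i} {l} eq with i Fin.≟ l
      ... | yes i≡l = i≡l
      ... | no  i≢l = contradiction (λ {x} → Adjoin-least Adjoin-isSubfield (gen ∘ avoid) ∘ generates) (essential i)
        where
        avoid : Image ⊆ ImageExcept i
        avoid (lift (l′ , x≈)) with l′ Fin.≟ i
        ... | yes ≡.refl = lift (l , i≢l ∘ ≡.sym , trans x≈ eq)
        ... | no  l′≢i   = lift (l′ , l′≢i , x≈)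

  module _ {M : Subset} (isSubfield : IsSubfield M) where
    open IsSubfield isSubfield

    sum∈ : ∀ {t} k → (∀ {j} → j ℕ.< k → M (t j)) → M (sum t k)
    sum∈ zero    Mt = ∈-0
    sum∈ (suc k) Mt = ∈-add (sum∈ k (Mt ∘ ℕ.m<n⇒m<1+n)) (Mt (ℕ.n<1+n k))

  θ̄ : ℕ → Carrier
  θ̄ j = bar j (θ-isRoot j)

  -- Irreducibility and generating sets for the dilated polynomials

  module Dilated {q : ℚ} (q≢0 : q ≢ 0ℚ) (k : ℕ) where

    p : ℚ[X]
    p = dilate q (f k)

    private
      instance
        q-nonZero : ℚ.NonZero q
        q-nonZero = ℚ.≢-nonZero q≢0

    q⁻¹ : ℚ
    q⁻¹ = ℚ.1/ q

    qq⁻¹≈1 : ι q * ι q⁻¹ ≈ 1#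
    qq⁻¹≈1 = trans (sym (*-homo q q⁻¹)) (trans (ι-cong (ℚ.*-inverseʳ q)) 1#-homo)

    undilate : ∀ x → ι q * (ι q⁻¹ * x) ≈ x
    undilate x = trans (sym (*-assoc _ _ _)) (trans (*-congʳ qq⁻¹≈1) (*-identityˡ x))

    undilate′ : ∀ x → ι q⁻¹ * (ι q * x) ≈ x
    undilate′ x = trans (solve 3 (λ a b x → b :* (a :* x) := a :* (b :* x)) refl (ι q) (ι q⁻¹) x) (undilate x)

    root⇒ : ∀ {x} → p ⟨ x ⟩ ≈ 0# → RootSum k (ι q * x)
    root⇒ {x} eq = f-root⇒ k (trans (sym (ev-dilate q (f k) x)) eq)

    root⇐ : ∀ {y} → RootSum k y → p ⟨ ι q⁻¹ * y ⟩ ≈ 0#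
    root⇐ {y} y-sum = trans (ev-dilate q (f k) _) (trans (ev-cong (f k) (undilate y)) (f-root⇐ y-sum))

    module _ {M : Subset} (isSubfield : IsSubfield M) where
      open IsSubfield isSubfield

      dilated∈ : ∀ {x} → M x → M (ι q * x)
      dilated∈ = ∈-mul (∈-rat q)

      undilated∈ : ∀ {x} → M x → M (ι q⁻¹ * x)
      undilated∈ = ∈-mul (∈-rat q⁻¹)

      dilated∈⁻¹ : ∀ {x} → M (ι q * x) → M x
      dilated∈⁻¹ {x} = ∈-resp (undilate′ x) ∘ undilated∈

      undilated∈⁻¹ : ∀ {x} → M (ι q⁻¹ * x) → M x
      undilated∈⁻¹ {x} = ∈-resp (undilate x) ∘ dilated∈

    p-simple : ∀ {y} → RootSum k y → SimpleRoot (p ⟨_⟩) (ι q⁻¹ * y)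
    p-simple {y} y-sum = record
      { quotient      = proj₁ Q
      ; factorisation = λ z → begin
          p ⟨ z ⟩                                                ≈⟨ ev-dilate q (f k) z ⟩
          f k ⟨ ι q * z ⟩                                        ≈⟨ factorisation (ι q * z) ⟩
          (ι q * z - y) * eval quotient (ι q * z)                ≈⟨ *-cong (+-congˡ (-‿cong (sym (undilate y)))) (eval-cong quotient (sym (+-identityʳ _))) ⟩
          (ι q * z - ι q * (ι q⁻¹ * y)) * eval quotient (ι q * z + 0#)
            ≈⟨ solve 4 (λ q z y h → (q :* z :- q :* y) :* h := (z :- y) :* (q :* h)) refl (ι q) z (ι q⁻¹ * y) (eval quotient (ι q * z + 0#)) ⟩
          (z - ι q⁻¹ * y) * (ι q * eval quotient (ι q * z + 0#)) ≈⟨ *-congˡ (proj₂ Q z) ⟩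
          (z - ι q⁻¹ * y) * eval (proj₁ Q) z                     ∎
      ; quotient≉0    = λ eq → *-≉0 (q≢0 ∘ ι-injective) quotient≉0 (trans
          (*-congˡ (eval-cong quotient (sym (trans (+-identityʳ _) (undilate y))))) (trans (proj₂ Q _) eq))
      }
      where
      open SimpleRoot (f-simple y-sum)
      Q : IsPolynomial (λ z → ι q * eval quotient (ι q * z + 0#))
      Q = polynomial-* (polynomial-const (ι q)) (polynomial-∘-linear (quotient , λ _ → refl) (ι q) 0#)

    p-irreducible : Irreducible p
    -- `conjugates-vanish` speaks of the roots of `f k`, so g is carried over to them as g(q⁻¹ X).
    p-irreducible = irreducible-criterion p (p-simple θ-sum) λ g {b} pb≈0 gb≈0 → trans
      (sym (ev-dilate q⁻¹ g _))
      (conjugates-vanish (root⇒ pb≈0) θ-sum (dilate q⁻¹ g)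
        (trans (ev-dilate q⁻¹ g _) (trans (ev-cong g (undilate′ b)) gb≈0)))
      where
      θ-sum = sum-RootSum {θ} θ-isRoot k

    -- T is a table with one row of summands per generator. Two entries of a column with product σ
    -- yield all roots of that quartic, which gives generation; a column constant outside row i
    -- makes generator i indispensable.
    minimal-generating-sums : ∀ {m} (T : Fin m → ℕ → Carrier) → (∀ i j → IsRoot j (T i j)) →
      (∀ {j} → j ℕ.< k → ∃ λ i → ∃ λ i′ → T i j * T i′ j ≈ σ j) →
      (∀ i → ∃ λ j → j ℕ.< k × ∃ λ t → IsRoot j t × (∀ {l} → l ≢ i → T l j ≈ t)) →
      HasMinimalGeneratingSetOfSize ℚ̄ p m
    minimal-generating-sums {m} T T-root generate agree =
      minimal-generating-set b (λ i → root⇐ (sum-RootSum {T i} (T-root i) k)) (generates ∘ root⇒) essential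
      where
      b : Fin m → Carrier
      b i = ι q⁻¹ * sum (T i) k

      N = Adjoin ℚ̄ (Image {p} b)

      generates : ∀ {x} → RootSum k (ι q * x) → N x
      generates = dilated∈⁻¹ Adjoin-isSubfield ∘ RootSum∈ Adjoin-isSubfield λ {j} j<k root →
        let i , i′ , eq = generate j<k
        in conjugate∈ j (T-root i j) Adjoin-isSubfield (T∈ i j<k) (resp eq (mul (T∈ i j<k) (T∈ i′ j<k))) root
        where
        T∈ : ∀ i {j} → j ℕ.< k → N (T i j)
        T∈ i = summands∈ Adjoin-isSubfield {T i} (T-root i) k (undilated∈⁻¹ Adjoin-isSubfield (gen (lift (i , refl))))

      -- Without b i, the j-th summands generate at most Q(t), and the roots
      -- generate a field without σ j over the other summands.
      essential : ∀ i → ¬ (Roots ℚ̄ p ⊆ Adjoin ℚ̄ (ImageExcept {p} b i))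
      essential i roots⊆ with agree i
      -- If M contained all roots of p, it would contain the j-th summands of Σ θ and of Σ θ̄, whose
      -- product is σ.
      ... | j , j<k , t , root , T≈t = σ∉F[r,t] root (M.∈-resp (t*bar≈σ j (θ-isRoot j))
            (M.∈-mul (summand∈M {θ} θ-isRoot) (summand∈M {θ̄} (λ j → bar-isRoot j (θ-isRoot j)))))
        where
        -- The index j may be anywhere below k, and its quartic has to be fresh over all the others;
        -- hence towers over arbitrary lists.
        others : List ℕ
        others = filter (λ l → ¬? (l ℕ.≟ j)) (downFrom k)

        open Fresh (fresh-L {j} {others} (filter⁺ (λ l → ¬? (l ℕ.≟ j)) (downFrom⁺ k))
          (All.map (λ l≢j → l≢j ∘ ≡.sym) (all-filter (λ l → ¬? (l ℕ.≟ j)) (downFrom k))))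
          hiding (isSubfield)

        M : Subset
        M = Ext (Ext (L others) (ρ j t)) t

        M-isSubfield : IsSubfield M
        M-isSubfield = F[r,t].Ext-isSubfield root

        module M = IsSubfield M-isSubfield

        T∈M : ∀ {l} → l ≢ i → ∀ {j′} → j′ ℕ.< k → M (T l j′)
        T∈M {l} l≢i {j′} j′<k with j′ ℕ.≟ j
        ... | yes ≡.refl = M.∈-resp (sym (T≈t l≢i)) (F[r,t].root∈ root)
        ... | no  j′≢j   = F[r,t].base root (F[r].base root (root∈L (∈-filter⁺ (λ l → ¬? (l ℕ.≟ j)) (∈-downFrom⁺ j′<k) j′≢j) (T-root l j′)))

        roots⊆M : ∀ {x} → Roots ℚ̄ p x → M x
        roots⊆M = Adjoin-least M-isSubfield (λ { (lift (l , l≢i , eq)) →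
          M.∈-resp (sym eq) (undilated∈ M-isSubfield (sum∈ M-isSubfield k (T∈M l≢i))) }) ∘ roots⊆

        summand∈M : ∀ {t′} → (∀ j → IsRoot j (t′ j)) → M (t′ j)
        summand∈M {t′} t′-root = summands∈ M-isSubfield {t′} t′-root k (undilated∈⁻¹ M-isSubfield (roots⊆M (root⇐ (sum-RootSum {t′} t′-root k)))) j<k

    -- Without one of two rows a single row is left, which is constant in every column; column 0
    -- exists by `0 < k`.
    two-generators : 0 ℕ.< k → HasMinimalGeneratingSetOfSize ℚ̄ p 2
    two-generators 0<k = minimal-generating-sums T T-root
      (λ {j} _ → zero , suc zero , t*bar≈σ j (θ-isRoot j))
      λ { zero       → 0 , 0<k , θ̄ 0 , bar-isRoot 0 (θ-isRoot 0) , λ { {zero} l≢i → contradiction ≡.refl l≢i ; {suc zero} _ → refl }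
        ; (suc zero) → 0 , 0<k , θ 0 , θ-isRoot 0 , λ { {zero} _ → refl ; {suc zero} l≢i → contradiction ≡.refl l≢i } }
      where
      T : Fin 2 → ℕ → Carrier
      T zero       = θ
      T (suc zero) = θ̄

      T-root : ∀ i j → IsRoot j (T i j)
      T-root zero       j = θ-isRoot j
      T-root (suc zero) j = bar-isRoot j (θ-isRoot j)

    k-generators : 1 ℕ.< k → HasMinimalGeneratingSetOfSize ℚ̄ p k
    k-generators 1<k = minimal-generating-sums (λ i → flip (toℕ i)) (λ i → flip-root (toℕ i))
      -- Column j has `θ̄ j` in row j and `θ j` in any other row, and another row exists by `1<k`.
      (λ {j} j<k → let i , i<k , i≢j = another j in fromℕ< i<k , fromℕ< j<k ,
        trans (*-cong (trans (reflexive (≡.cong (λ i → flip i j) (Fin.toℕ-fromℕ< i<k))) (flip-≢ (i≢j ∘ ≡.sym)))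
                      (trans (reflexive (≡.cong (λ i → flip i j) (Fin.toℕ-fromℕ< j<k))) (flip-≡ j)))
              (t*bar≈σ j (θ-isRoot j)))
      (λ i → toℕ i , Fin.toℕ<n i , θ (toℕ i) , θ-isRoot (toℕ i) , λ l≢i → flip-≢ (l≢i ∘ Fin.toℕ-injective ∘ ≡.sym))
      where
      flip : ℕ → ℕ → Carrier
      flip i j with j ℕ.≟ i
      ... | yes _ = θ̄ j
      ... | no  _ = θ j

      flip-≢ : ∀ {i j} → j ≢ i → flip i j ≈ θ j
      flip-≢ {i} {j} j≢i with j ℕ.≟ i
      ... | yes j≡i = contradiction j≡i j≢i
      ... | no  _   = refl

      flip-≡ : ∀ i → flip i i ≈ θ̄ i
      flip-≡ i with i ℕ.≟ i
      ... | yes _   = refl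
      ... | no  i≢i = contradiction ≡.refl i≢i

      flip-root : ∀ i j → IsRoot j (flip i j)
      flip-root i j with j ℕ.≟ i
      ... | yes _ = bar-isRoot j (θ-isRoot j)
      ... | no  _ = θ-isRoot j

      another : ∀ j → ∃ λ i → i ℕ.< k × i ≢ j
      another zero    = 1 , 1<k , λ ()
      another (suc j) = 0 , ℕ.<-trans (ℕ.s≤s ℕ.z≤n) 1<k , λ ()

  -- Infinitely many pairwise non-associated dilations

  2^ : ℕ → ℚ
  2^ n = fromℤ (+ (2 ℕ.^ n))

  2^≢0 : ∀ n → 2^ n ≢ 0ℚ
  2^≢0 n eq = ℕ.≢-nonZero⁻¹ (2 ℕ.^ n) {{ℕ.m^n≢0 2 n}} (ℤ.+-injective (≡.cong ℚ.ℚ.numerator eq))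

  ν-2^-+ : ∀ m n → ν (2 ℕ.^ (m ℕ.+ n)) ≈ ν (2 ℕ.^ m) * ν (2 ℕ.^ n)
  ν-2^-+ m n = trans (ι-cong (≡.cong (fromℤ ∘ +_) (ℕ.^-distribˡ-+-* 2 m n))) (ν-* (2 ℕ.^ m) (2 ℕ.^ n))

  2^-injective : ∀ {m n} → 2 ℕ.^ m ≡ 2 ℕ.^ n → m ≡ n
  2^-injective {m} {n} eq with ℕ.<-cmp m n
  ... | tri< m<n _ _ = contradiction eq (ℕ.<⇒≢ (ℕ.^-monoʳ-< 2 (ℕ.s≤s (ℕ.s≤s ℕ.z≤n)) m<n))
  ... | tri≈ _ m≡n _ = m≡n
  ... | tri> _ _ n<m = contradiction (≡.sym eq) (ℕ.<⇒≢ (ℕ.^-monoʳ-< 2 (ℕ.s≤s (ℕ.s≤s ℕ.z≤n)) n<m))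

  module Family (k : ℕ) (0<k : 0 ℕ.< k) where

    family : ℕ → ℚ[X]
    family n = dilate (2^ n) (f k)

    private
      a : Carrier
      a = sum θ k

      a-sum : RootSum k a
      a-sum = sum-RootSum {θ} θ-isRoot k

    -- A rational sum Σ θ would have rational summands, but θ 0 is irrational because the quartic 0
    -- is fresh over ℚ.
    a≉0 : ¬ a ≈ 0#
    a≉0 a≈0 = t∉F[r] (θ-isRoot 0) (F[r].base (θ-isRoot 0)
        (summands∈ isSubfield {θ} θ-isRoot k (IsSubfield.∈-resp isSubfield (sym a≈0) (IsSubfield.∈-0 isSubfield)) 0<k))
      where open Fresh (fresh-L {0} {[]} [] [])

    f≉0 : ¬ (∀ x → f k ⟨ x ⟩ ≈ 0#)
    f≉0 f≈0 = SimpleRoot.quotient-unique (f-simple a-sum) (polynomial-const 0#)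
      (λ z → trans (f≈0 z) (sym (zeroʳ _))) refl

    -- The roots of f k are finitely many, so not closed under dilation.
    dilation-not-closed : ∀ {s} → s ≢ 0 → ¬ (∀ {y} → RootSum k y → RootSum k (ν (2 ℕ.^ s) * y))
    dilation-not-closed {s} s≢0 closed = f≉0 (infinitely-many-roots⇒≈0 (map ι (f k)) ys distinct (f-root⇐ ∘ ys-sum))
      where
      ys : ℕ → Carrier
      ys i = ν (2 ℕ.^ (i ℕ.* s)) * a

      resp-sum : ∀ {x y} → x ≈ y → RootSum k x → RootSum k y
      resp-sum x≈y = f-root⇒ k ∘ trans (ev-cong (f k) (sym x≈y)) ∘ f-root⇐

      ys-sum : ∀ i → RootSum k (ys i)
      ys-sum zero    = resp-sum (sym (trans (*-congʳ 1#-homo) (*-identityˡ a))) a-sum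
      ys-sum (suc i) = resp-sum (trans (sym (*-assoc _ _ a)) (*-congʳ (sym (ν-2^-+ s (i ℕ.* s))))) (closed (ys-sum i))

      distinct : ∀ {i j} → i ≢ j → ¬ ys i ≈ ys j
      distinct {i} {j} i≢j eq = i≢j (ℕ.*-cancelʳ-≡ i j s {{ℕ.≢-nonZero s≢0}}
        (2^-injective (ν-injective (*-cancelˡ-≈ a≉0 (trans (*-comm a _) (trans eq (*-comm _ a)))))))

    -- Divisibility turns every root of the m-th dilation into a root of the n-th, so the roots of
    -- `f k` would be closed under multiplication by 2 to the power n - m.
    family-∤ : ∀ {m n} → m ℕ.< n → ¬ (∃ λ h → (h *ₚ family m) ≈ₚ family n)
    family-∤ {m} {n} m<n (h , h*pₘ≈pₙ) = dilation-not-closed {n ℕ.∸ m} (ℕ.m>n⇒m∸n≢0 m<n) λ {y} y-sum →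
      f-root⇒ k (trans (ev-cong (f k) (sym (scaled y))) (f-root⇐ (Dₙ.root⇒ (trans (sym (ev-≈ₚ (h *ₚ family m) (family n) h*pₘ≈pₙ _))
        (trans (ev-* h (family m) _) (trans (*-congˡ (Dₘ.root⇐ y-sum)) (zeroʳ _)))))))
      where
      module Dₘ = Dilated (2^≢0 m) k
      module Dₙ = Dilated (2^≢0 n) k

      scaled : ∀ y → ι (2^ n) * (ι Dₘ.q⁻¹ * y) ≈ ν (2 ℕ.^ (n ℕ.∸ m)) * y
      scaled y = begin
        ν (2 ℕ.^ n) * (ι Dₘ.q⁻¹ * y)
          ≈⟨ *-congʳ (trans (reflexive (≡.cong (λ i → ν (2 ℕ.^ i)) (≡.sym (ℕ.m∸n+n≡m (ℕ.<⇒≤ m<n))))) (ν-2^-+ (n ℕ.∸ m) m)) ⟩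
        (ν (2 ℕ.^ (n ℕ.∸ m)) * ν (2 ℕ.^ m)) * (ι Dₘ.q⁻¹ * y)
          ≈⟨ trans (*-assoc _ _ _) (*-congˡ (Dₘ.undilate y)) ⟩
        ν (2 ℕ.^ (n ℕ.∸ m)) * y ∎

    family-injective : ∀ m n → Associated (family m) (family n) → m ≡ n
    family-injective m n ((h ∣, pₘ∣pₙ) , (h′ ∣, pₙ∣pₘ)) with ℕ.<-cmp m n
    ... | tri< m<n _ _ = contradiction (h , pₘ∣pₙ) (family-∤ m<n)
    ... | tri≈ _ m≡n _ = m≡n
    ... | tri> _ _ n<m = contradiction (h′ , pₙ∣pₘ) (family-∤ n<m)

    -- The value 4ᵏ is never computed: some degree exists because `f k` is not zero, and dilation by
    -- a nonzero rational preserves it.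
    f-degree : ∃ (HasDegreeℚ (f k))
    f-degree = Sum.[ (λ f≈0 → contradiction (ev-0 (f k) f≈0) f≉0) , (λ deg → deg) ]′ (degree? (f k))

    family-degree : ∀ n → HasDegreeℚ (family n) (proj₁ f-degree)
    family-degree n = dilate-degree (2^≢0 n) (f k) (proj₂ f-degree)

proposition2p5 : ∀ {c ℓ₁ ℓ₂ : Level} (ℚ̄ : AlgebraicClosure c ℓ₁ ℓ₂) (k : ℕ) → 2 < k →
    InfinitelyMany (λ f →
    Irreducible f ×
    HasMinimalGeneratingSetOfSize ℚ̄ f 2 ×
    HasMinimalGeneratingSetOfSize ℚ̄ f k)
    ×
    Σ ℕ (λ d → InfinitelyMany (λ f →
    HasDegreeℚ f d ×
    Irreducible f ×
    HasMinimalGeneratingSetOfSize ℚ̄ f 2 ×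
    HasMinimalGeneratingSetOfSize ℚ̄ f k))
proposition2p5 ℚ̄ k 2<k =
  (family , good , family-injective) , proj₁ f-degree , family , (λ n → family-degree n , good n) , family-injective
  where
  open Closure ℚ̄
  1<k = ℕ.<-trans (ℕ.n<1+n 1) 2<k
  0<k = ℕ.<-trans (ℕ.n<1+n 0) 1<k
  open Family k 0<k

  good : ∀ n → Irreducible (family n) × HasMinimalGeneratingSetOfSize ℚ̄ (family n) 2 × HasMinimalGeneratingSetOfSize ℚ̄ (family n) k
  good n = p-irreducible , two-generators 0<k , k-generators 1<k
    where open Dilated (2^≢0 n) k
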